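{- For every $n\ge 1$: (a) $|I_n(010,101,120,201)|=|I_n(011,201)|$. (b) Let $C$ be any of the classes $I_n(010,101,120,201)$, $I_n(010,110,120,210)$, $I_n(010,100,120,210)$. For $e\in C$ let $a(e)$ be the number of entries equal to $0$, $b(e)$ the number of left-to-right maxima, $c(e)$ the bounce, and $d(e)$ the number of high entries. For $e\in I_n(011,201)$ let $x(e)$ be the number of high entries, $y(e)$ the number of entries equal to $0$, $z(e)$ the number of right-to-left minima, and $t(e)$ the bounce. Then the quadruple of statistics $(a,b,c,d)$ on $C$ has the same joint distribution as the quadruple $(x,y,z,t)$ on $I_n(011,201)$; i.e. for every quadruple $q$ of integers, $|\{e\in C:(a,b,c,d)(e)=q\}|=|\{e\in I_n(011,201):(x,y,z,t)(e)=q\}|$. Moreover, $a$ can be switched with $c$, and $x$ with $z$ (that is, $(a,b,c,d)$ and $(c,b,a,d)$ have the same joint distribution on $C$, and $(x,y,z,t)$ and $(z,y,x,t)$ have the same joint distribution on $I_n(011,201)$).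
   Context: An inversion sequence of length $n$ is an integer sequence $e=(e_1,\dots,e_n)$ with $0\le e_j\le j-1$. $e$ contains a pattern $f=(f_1,\dots,f_m)$ if there are indices $i_1<\dots<i_m$ with $e_{i_a}<e_{i_b}$ iff $f_a<f_b$ and $e_{i_a}=e_{i_b}$ iff $f_a=f_b$ for all $a,b$; otherwise it avoids $f$. $I_n(T)$ is the set of inversion sequences of length $n$ avoiding all patterns in $T$. An entry $e_j$ is high if $e_j=j-1$. The bounce of $e$ is $n-M$ where $M=\max_j e_j$. An entry $e_j$ is a left-to-right maximum if $e_j>e_i$ for all $i<j$ (in particular $e_1$ is one), and a right-to-left minimum if $e_j<e_k$ for all $k>j$ (in particular $e_n$ is one). -}

module Defs where

open import Data.Nat using (ℕ; zero; suc; _∸_; _⊔_; _≡ᵇ_; _<ᵇ_)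
open import Data.Bool using (Bool; true; false; _∧_; _∨_; not; if_then_else_)
open import Data.List using (List; []; _∷_; _++_; [_]; map; concatMap; length; upTo; zip; foldr)
open import Data.Bool.ListAction using (all; any)
open import Data.Product using (_×_; _,_; proj₁; proj₂)

-- Sequences are lists of naturals e = (e₁,…,eₙ) (written 0-indexed below).

-- All inversion sequences of length n: e_j ∈ {0,…,j-1} for 1 ≤ j ≤ n.
-- Built by appending a last entry e_{n+1} ∈ {0,…,n} to each sequence of length n.
invSeqs : ℕ → List (List ℕ)
invSeqs zero    = [] ∷ []
invSeqs (suc n) = concatMap (λ e → map (λ k → e ++ [ k ]) (upTo (suc n))) (invSeqs n)

_⇔ᵇ_ : Bool → Bool → Bool
true  ⇔ᵇ b = b
false ⇔ᵇ b = not b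

subseqs : List ℕ → List (List ℕ)
subseqs []       = [] ∷ []
subseqs (x ∷ xs) = map (x ∷_) (subseqs xs) ++ subseqs xs

orderIso : List ℕ → List ℕ → Bool
orderIso s f =
  (length s ≡ᵇ length f) ∧
  all (λ p → all (λ q →
        ((proj₁ p <ᵇ proj₁ q) ⇔ᵇ (proj₂ p <ᵇ proj₂ q)) ∧
        ((proj₁ p ≡ᵇ proj₁ q) ⇔ᵇ (proj₂ p ≡ᵇ proj₂ q))) ps) ps
  where ps = zip s f

contains : List ℕ → List ℕ → Bool
contains e f = any (λ s → orderIso s f) (subseqs e)

avoidsAll : List (List ℕ) → List ℕ → Bool
avoidsAll T e = all (λ f → not (contains e f)) T

countInv : ℕ → (List ℕ → Bool) → ℕ
countInv n P = length (Data.List.filterᵇ P (invSeqs n))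
  where import Data.List

zeros : List ℕ → ℕ
zeros []       = 0
zeros (x ∷ xs) = (if x ≡ᵇ 0 then 1 else 0) Data.Nat.+ zeros xs
  where import Data.Nat

-- number of high entries: e_j = j - 1 (with j starting at 1); `highFrom j` scans from position j
highFrom : ℕ → List ℕ → ℕ
highFrom j []       = 0
highFrom j (x ∷ xs) = (if x ≡ᵇ j then 1 else 0) Data.Nat.+ highFrom (suc j) xs
  where import Data.Nat

high : List ℕ → ℕ
high = highFrom 0

-- maximum entry (0 for the empty sequence; only used for n ≥ 1)
maxEntry : List ℕ → ℕ
maxEntry = foldr _⊔_ 0

bounce : List ℕ → ℕ
bounce e = length e ∸ maxEntry e

ltrFrom : List ℕ → List ℕ → ℕ
ltrFrom pre []       = 0
ltrFrom pre (x ∷ xs) = (if all (λ y → y <ᵇ x) pre then 1 else 0) Data.Nat.+ ltrFrom (pre ++ [ x ]) xs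
  where import Data.Nat

ltrMax : List ℕ → ℕ
ltrMax = ltrFrom []

rtlMin : List ℕ → ℕ
rtlMin []       = 0
rtlMin (x ∷ xs) = (if all (λ y → x <ᵇ y) xs then 1 else 0) Data.Nat.+ rtlMin xs
  where import Data.Nat

Stat : Set
Stat = List ℕ → ℕ

jointCount : ℕ → List (List ℕ) → Stat → Stat → Stat → Stat → ℕ → ℕ → ℕ → ℕ → ℕ
jointCount n T s₁ s₂ s₃ s₄ q₁ q₂ q₃ q₄ =
  countInv n (λ e → avoidsAll T e ∧ (s₁ e ≡ᵇ q₁) ∧ (s₂ e ≡ᵇ q₂) ∧ (s₃ e ≡ᵇ q₃) ∧ (s₄ e ≡ᵇ q₄))

p010 p101 p120 p201 p011 p110 p210 p100 : List ℕ
p010 = 0 ∷ 1 ∷ 0 ∷ []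
p101 = 1 ∷ 0 ∷ 1 ∷ []
p120 = 1 ∷ 2 ∷ 0 ∷ []
p201 = 2 ∷ 0 ∷ 1 ∷ []
p011 = 0 ∷ 1 ∷ 1 ∷ []
p110 = 1 ∷ 1 ∷ 0 ∷ []
p210 = 2 ∷ 1 ∷ 0 ∷ []
p100 = 1 ∷ 0 ∷ 0 ∷ []

T₁ T₂ T₃ T₀ : List (List ℕ)
T₁ = p010 ∷ p101 ∷ p120 ∷ p201 ∷ []
T₂ = p010 ∷ p110 ∷ p120 ∷ p210 ∷ []
T₃ = p010 ∷ p100 ∷ p120 ∷ p210 ∷ []
T₀ = p011 ∷ p201 ∷ []

card : ℕ → List (List ℕ) → ℕ
card n T = countInv n (avoidsAll T)

{-# OPTIONS --safe #-}
-- A sequence in C splits at its left-to-right maxima m₀ < m₁ < … into blocks, the block of mₜ having its entries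
-- in (mₜ₋₁ , mₜ].  In the three classes the blocks are, after their first entry, the weakly decreasing words, the
-- weakly increasing words, and the words whose letters other than mₜ increase strictly; read entry by entry they
-- are generated by one and the same tree, labelled by n − max and the number of ways to continue the block.
--
-- On the other side, a sequence avoiding 011 and 201 arises from 0^z by inserting successive maxima.  The maximum M
-- may be inserted at a position ≥ M that is followed by a weakly decreasing run, so the label (bounce , length of
-- the final decreasing run) of the sequence passes from (α , β) to any (α′ , β′) with α′ ≤ α and β′ ≤ min(β+1 , α′);
-- the insertion creates a right-to-left minimum iff β′ = 1 and a high entry iff β′ = α′.
--
-- Let u mark right-to-left minima (the bounce on C) and Y high entries (zeros on C), both less one, let q mark the
-- bounce (high entries on C) and t the nonzero entries (those that are not left-to-right maxima on C), and
-- put φ = 1/(1 − t u).  Opening a new block acts on series by the linear operator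
-- ρ(u^i) = u^i φ + u^{i−1} φ² + … + u φ^i + q φ^{i+1}, and the series G_{α,β} of the insertion tree
-- satisfy ρ(G_{α,β}) = G_{α+1,β+1}.  Hence the series for z zeros is G_{z,z} = ρ^{z−1}(q Σ_m (t u Y)^m), which is
-- the series of C for z left-to-right maxima.  It is symmetric in u and Y, because ρ commutes with its analogue
-- acting on Y, and the two agree on Σ_m (t u Y)^m.

module Submission where

open import Defs
open import Data.Bool using (Bool; true; false; if_then_else_; _∧_; T; T?)
open import Data.Bool.Properties using (∧-zeroʳ; ¬-not; T-≡)
open import Data.Bool.ListAction using (all; any)
open import Data.Nat
open import Data.Nat.Properties
open import Data.Nat.Tactic.RingSolver using (solve-∀)
open import Data.List using (List; []; _∷_; _++_; [_]; map; concatMap; length; upTo; applyUpTo; filterᵇ; take; drop; replicate; initLast; _∷ʳ′_)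
open import Data.List.Properties using (length-++; ++-assoc; ++-identityʳ; ∷-injective; ∷ʳ-injective; take++drop≡id; length-take; length-drop; length-replicate)
open import Data.List.Relation.Binary.Sublist.Propositional using (_⊆_; []; _∷_; _∷ʳ_; minimum; ⊆-refl; ⊆-trans)
open import Data.List.Relation.Binary.Sublist.Propositional.Properties using (++⁺; ++⁺ʳ; ++⁺ˡ)
open import Data.List.Relation.Unary.All as All using (All; []; _∷_)
open import Data.List.Relation.Unary.Any using (here; there)
open import Data.List.Relation.Unary.AllPairs using ([]; _∷_)
open import Data.List.Relation.Unary.Unique.Propositional using (Unique)
import Data.List.Relation.Unary.Unique.Propositional.Properties as Unique
open import Data.List.Membership.Propositional using (_∈_; find; lose)
open import Data.List.Membership.Propositional.Properties using (∈-map⁻; ∈-map⁺; ∈-++⁻; ∈-++⁺ˡ; ∈-++⁺ʳ; ∈-concatMap⁺; ∈-concatMap⁻; ∈-upTo⁺; ∈-upTo⁻; ∈-filter⁺; ∈-filter⁻)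
open import Data.List.Membership.Propositional.Properties.WithK using (unique∧set⇒bag)
open import Data.List.Relation.Binary.BagAndSetEquality using (∼bag⇒↭)
open import Data.List.Relation.Binary.Permutation.Propositional.Properties using (↭-length)
open import Data.Product using (_×_; _,_; proj₁; proj₂; ∃-syntax)
open import Data.Sum using (_⊎_; inj₁; inj₂) renaming (map to map-⊎)
open import Data.Empty using (⊥; ⊥-elim)
open import Data.Unit using (⊤; tt)
open import Function using (_∘_)
open import Function.Bundles using (mk⇔; Equivalence)
open import Relation.Nullary using (¬_; yes; no)
open import Relation.Binary.Definitions using (tri<; tri≈; tri>)
open import Relation.Binary.PropositionalEquality hiding ([_])

-- Finite sums.

∑ : ℕ → (ℕ → ℕ) → ℕ
∑ zero    f = 0
∑ (suc n) f = f 0 + ∑ n (λ i → f (suc i))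

∑-cong : ∀ n {f g : ℕ → ℕ} → (∀ i → f i ≡ g i) → ∑ n f ≡ ∑ n g
∑-cong zero    p = refl
∑-cong (suc n) p = cong₂ _+_ (p 0) (∑-cong n (λ i → p (suc i)))

interchange : ∀ a b c d → (a + b) + (c + d) ≡ (a + c) + (b + d)
interchange = solve-∀

∑-+ : ∀ n f g → ∑ n (λ i → f i + g i) ≡ ∑ n f + ∑ n g
∑-+ zero    f g = refl
∑-+ (suc n) f g = trans (cong (f 0 + g 0 +_) (∑-+ n _ _)) (interchange (f 0) _ _ _)

∑-last : ∀ n f → ∑ (suc n) f ≡ ∑ n f + f n
∑-last zero    f = +-comm (f 0) 0
∑-last (suc n) f = trans (cong (f 0 +_) (∑-last n _)) (sym (+-assoc (f 0) _ _))

∑-zero : ∀ n → ∑ n (λ _ → 0) ≡ 0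
∑-zero zero    = refl
∑-zero (suc n) = ∑-zero n

-- The insertion tree and the operator ρ.

bump : Bool → ℕ → ℕ
bump b n = if b then suc n else n

-- A power series in u, Y, q, t is represented by its action on functionals:
-- X K i j d is the value of X at u^i Y^j q^d when K powers of t remain to be spent.
Functional : Set
Functional = ℕ → ℕ → ℕ → ℕ → ℕ

-- The action of u^i Y^j G_{α,β}, where G_{α,β} enumerates the insertion tree below the label (α , β).
-- The indices a and b of the sums stand for the labels suc a and suc b.
growth : Functional → ℕ → ℕ → ℕ → ℕ → ℕ → ℕ
growth X zero    α β i j = X 0 i j α
growth X (suc K) α β i j = X (suc K) i j α +
  ∑ α (λ a → ∑ (suc β ⊓ suc a) (λ b → growth X K (suc a) (suc b) (bump (b ≡ᵇ 0) i) (bump (b ≡ᵇ a) j)))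

-- The action of u^l ρ(u^i), from ρ(1) = q + t u ρ(1) and ρ(u^{i+1}) = ρ(u^i) + u^{i+1} + t u ρ(u^{i+1}).
valley : Functional → ℕ → ℕ → ℕ → ℕ → ℕ → ℕ
valley X zero    zero    l j d = X 0 l j (suc d)
valley X zero    (suc i) l j d = valley X zero i l j d + X 0 (suc (i + l)) j d
valley X (suc K) zero    l j d = X (suc K) l j (suc d) + valley X K zero (suc l) j d
valley X (suc K) (suc i) l j d = valley X (suc K) i l j d + X (suc K) (suc (i + l)) j d + valley X K (suc i) (suc l) j d

valleyₗ : Functional → ℕ → Functional
valleyₗ X l K i j d = valley X K i l j d

-- Stands for t G_{α,β}: one power of t is spent in advance, and if none remains the value is 0.
growth-pred : Functional → ℕ → ℕ → ℕ → ℕ → ℕ → ℕ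
growth-pred X zero    α β i j = 0
growth-pred X (suc K) α β i j = growth X K α β i j

suc-bump : ∀ b i → bump b (suc i) ≡ suc (bump b i)
suc-bump false i = refl
suc-bump true  i = refl

+-bump : ∀ b i l → bump b (i + l) ≡ bump b i + l
+-bump false i l = refl
+-bump true  i l = refl

-- The functional equation ρ(u f) = ρ(f) + u f + t u ρ(u f) for f = u^i G_{α,β}.
growth-valley : ∀ X K l α β i j →
  growth (valleyₗ X l) K α β (suc i) j ≡
  growth (valleyₗ X l) K α β i j + growth X K α β (suc (i + l)) j + growth-pred (valleyₗ X (suc l)) K α β (suc i) j
growth-valley X zero    l α β i j = sym (+-identityʳ _)
growth-valley X (suc K) l α β i j = trans (cong (valley X (suc K) (suc i) l j α +_) sums)
  (trans (shuffle (valley X (suc K) i l j α) (X (suc K) (suc (i + l)) j α) _ (∑∑ p) (∑∑ q) (∑∑ r))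
    (cong (λ z → valley X (suc K) i l j α + ∑∑ p + (X (suc K) (suc (i + l)) j α + ∑∑ q) + z) (last K)))
  where
  open ≡-Reasoning
  ∑∑ : (ℕ → ℕ → ℕ) → ℕ
  ∑∑ f = ∑ α (λ a → ∑ (suc β ⊓ suc a) (f a))
  p q r : ℕ → ℕ → ℕ
  p a b = growth (valleyₗ X l) K (suc a) (suc b) (bump (b ≡ᵇ 0) i) (bump (b ≡ᵇ a) j)
  q a b = growth X K (suc a) (suc b) (bump (b ≡ᵇ 0) (suc (i + l))) (bump (b ≡ᵇ a) j)
  r a b = growth-pred (valleyₗ X (suc l)) K (suc a) (suc b) (bump (b ≡ᵇ 0) (suc i)) (bump (b ≡ᵇ a) j)
  ∑∑-+ : ∀ f g → ∑∑ (λ a b → f a b + g a b) ≡ ∑∑ f + ∑∑ g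
  ∑∑-+ f g = trans (∑-cong α (λ a → ∑-+ (suc β ⊓ suc a) (f a) (g a))) (∑-+ α _ _)
  step : ∀ a b → growth (valleyₗ X l) K (suc a) (suc b) (bump (b ≡ᵇ 0) (suc i)) (bump (b ≡ᵇ a) j) ≡ p a b + q a b + r a b
  step a b rewrite suc-bump (b ≡ᵇ 0) (i + l) | suc-bump (b ≡ᵇ 0) i | +-bump (b ≡ᵇ 0) i l = growth-valley X K l (suc a) (suc b) _ _
  sums : ∑∑ (λ a b → growth (valleyₗ X l) K (suc a) (suc b) (bump (b ≡ᵇ 0) (suc i)) (bump (b ≡ᵇ a) j)) ≡ ∑∑ p + ∑∑ q + ∑∑ r
  sums = begin
    _ ≡⟨ ∑-cong α (λ a → ∑-cong (suc β ⊓ suc a) (step a)) ⟩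
    ∑∑ (λ a b → p a b + q a b + r a b) ≡⟨ ∑∑-+ (λ a b → p a b + q a b) r ⟩
    ∑∑ (λ a b → p a b + q a b) + ∑∑ r ≡⟨ cong (_+ ∑∑ r) (∑∑-+ p q) ⟩
    ∑∑ p + ∑∑ q + ∑∑ r ∎
  shuffle : ∀ a b c x y z → (a + b + c) + (x + y + z) ≡ a + x + (b + y) + (c + z)
  shuffle = solve-∀
  -- The t u ρ term at the root and those at the descendants together form the same tree with one
  -- power of t less.
  last : ∀ K → valley X K (suc i) (suc l) j α + ∑ α (λ a → ∑ (suc β ⊓ suc a) (λ b → growth-pred (valleyₗ X (suc l)) K (suc a) (suc b) (bump (b ≡ᵇ 0) (suc i)) (bump (b ≡ᵇ a) j)))
       ≡ growth (valleyₗ X (suc l)) K α β (suc i) j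
  last zero    = trans (cong (valley X 0 (suc i) (suc l) j α +_) (trans (∑-cong α (λ a → ∑-zero (suc β ⊓ suc a))) (∑-zero α))) (+-identityʳ _)
  last (suc K) = refl

-- ρ(G_{α,β}) = G_{α+1,β+1}, times u^l; ρ(u f) is eliminated by growth-valley, and the leftover sum
-- telescopes to the case β = 0 of the same identity, in lower degree in t.
growth-transfer : ∀ X K l α β j → growth (valleyₗ X l) K (suc α) β 0 j ≡ growth X K (suc (suc α)) (suc β) l j
growth-transfer X zero    l α β j = refl
growth-transfer X (suc K) l α β j = begin
  x + y + ∑ (suc α) (λ a → A a + C a)
    -- Only the children with b = 0 gain a factor u, so the functional equation is applied to these,
    -- the `A a`. Since a child with b = 0 < a is not high, `E (suc a)` is `H a`.
    ≡⟨ cong (x + y +_) (trans (∑-+ (suc α) A C) (cong (_+ ∑C) (trans (∑-cong (suc α) star) (trans (∑-+ (suc α) (λ a → D a + E a) F) (cong (_+ ∑F) (∑-+ (suc α) D E)))))) ⟩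
  x + y + (∑D + (E 0 + ∑ α (λ a → H a)) + ∑F + ∑C)
    ≡⟨ s₁ x y ∑D (E 0) (∑ α H) ∑F ∑C ⟩
  x + (E 0 + (∑ α H + (y + ∑F)) + (∑D + ∑C))
    -- `y + ∑F` is a whole tree with β = 0, where each a has the single child b = 0. By induction it
    -- equals `H α`, the term that extends the sum of the `H a` by one.
    ≡⟨ cong (λ z → x + (E 0 + (∑ α H + z) + (∑D + ∑C))) (last K (growth-transfer X K (suc l) α 0 j)) ⟩
  x + (E 0 + (∑ α H + H α) + (∑D + ∑C))
    ≡⟨ cong (λ z → x + (E 0 + z + (∑D + ∑C))) (sym (∑-last α H)) ⟩
  x + (E 0 + ∑ (suc α) H + (∑D + ∑C))
    ≡⟨ cong (x +_) (+-assoc (E 0) _ _) ⟩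
  x + (E 0 + (∑ (suc α) H + (∑D + ∑C)))
    ≡⟨ cong (λ z → x + (E 0 + z)) (sym (trans (∑-+ (suc α) H (λ a → D a + C a)) (cong (∑ (suc α) H +_) (∑-+ (suc α) D C)))) ⟩
  x + (E 0 + ∑ (suc α) (λ a → H a + (D a + C a)))
    ≡⟨ cong (x +_) (cong₂ _+_ (sym (+-identityʳ (E 0))) (∑-cong (suc α) {λ a → H a + (D a + C a)} rhs)) ⟩
  x + (∑ (suc (suc β ⊓ 0)) (λ b → growth X K 1 (suc b) (bump (b ≡ᵇ 0) l) (bump (b ≡ᵇ 0) j)) +
       ∑ (suc α) (λ a → ∑ (suc (suc β ⊓ suc a)) (λ b → growth X K (suc (suc a)) (suc b) (bump (b ≡ᵇ 0) l) (bump (b ≡ᵇ suc a) j)))) ∎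
  where
  open ≡-Reasoning
  x = X (suc K) l j (suc (suc α))
  y = valley X K 0 (suc l) j (suc α)
  A C D E F H : ℕ → ℕ
  A a = growth (valleyₗ X l) K (suc a) 1 1 (bump (0 ≡ᵇ a) j)
  C a = ∑ (β ⊓ a) (λ b → growth (valleyₗ X l) K (suc a) (suc (suc b)) 0 (bump (suc b ≡ᵇ a) j))
  D a = growth (valleyₗ X l) K (suc a) 1 0 (bump (0 ≡ᵇ a) j)
  E a = growth X K (suc a) 1 (suc l) (bump (0 ≡ᵇ a) j)
  F a = growth-pred (valleyₗ X (suc l)) K (suc a) 1 1 (bump (0 ≡ᵇ a) j)
  H a = growth X K (suc (suc a)) 1 (suc l) j
  ∑C = ∑ (suc α) C
  ∑D = ∑ (suc α) D
  ∑F = ∑ (suc α) F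
  star : ∀ a → A a ≡ D a + E a + F a
  star a = growth-valley X K l (suc a) 1 0 (bump (0 ≡ᵇ a) j)
  s₁ : ∀ x y d e h f c → x + y + (d + (e + h) + f + c) ≡ x + (e + (h + (y + f)) + (d + c))
  s₁ = solve-∀
  last : ∀ K → growth (valleyₗ X (suc l)) K (suc α) 0 0 j ≡ growth X K (suc (suc α)) 1 (suc l) j →
    valley X K 0 (suc l) j (suc α) + ∑ (suc α) (λ a → growth-pred (valleyₗ X (suc l)) K (suc a) 1 1 (bump (0 ≡ᵇ a) j)) ≡ growth X K (suc (suc α)) 1 (suc l) j
  last zero    ih = trans (trans (cong (valley X 0 0 (suc l) j (suc α) +_) (∑-zero (suc α))) (+-identityʳ _)) ih
  last (suc K) ih = trans (cong (valley X (suc K) 0 (suc l) j (suc α) +_) (∑-cong (suc α) {F′} {λ a → F′ a + 0} (λ a → sym (+-identityʳ (F′ a))))) ih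
    where
    F′ : ℕ → ℕ
    F′ a = growth (valleyₗ X (suc l)) K (suc a) 1 1 (bump (0 ≡ᵇ a) j)
  rhs : ∀ a → H a + (D a + C a) ≡ H a + ∑ (suc β ⊓ suc a) (λ b → growth X K (suc (suc a)) (suc (suc b)) l (bump (b ≡ᵇ a) j))
  -- `D a` restores the missing term b = 0 of `C a`. By induction each of these trees has both
  -- labels raised by one, which gives the children with b ≥ 1 on the right.
  rhs a = cong (H a +_) (∑-cong (suc β ⊓ suc a) {λ b → growth (valleyₗ X l) K (suc a) (suc b) 0 (bump (b ≡ᵇ a) j)} (λ b → growth-transfer X K l a (suc b) (bump (b ≡ᵇ a) j)))

-- Symmetry

infix 4 _≗₄_
_≗₄_ : Functional → Functional → Set
X ≗₄ Y = ∀ K i j d → X K i j d ≡ Y K i j d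

R : Functional → Functional
R X = valleyₗ X 0

R^ : ℕ → Functional → Functional
R^ zero    X = X
R^ (suc s) X = R (R^ s X)

R^-R : ∀ s X → R^ s (R X) ≡ R (R^ s X)
R^-R zero    X = refl
R^-R (suc s) X = cong R (R^-R s X)

-- The action of q u^i Y^j Σ_m (t u Y)^m, which is u^i Y^j G_{1,β} for any β.
Δ : Functional → ℕ → ℕ → ℕ → ℕ
Δ X zero    i j = X 0 i j 1
Δ X (suc K) i j = X (suc K) i j 1 + Δ X K (suc i) (suc j)

-- With α = 1 the only child is a = b = 0, whatever β is; it is both a right-to-left minimum and
-- high, so each generation contributes t u Y.
growth-one : ∀ X K β i j → growth X K 1 β i j ≡ Δ X K i j
growth-one X zero    β i j = refl
growth-one X (suc K) β i j rewrite ⊓-zeroʳ β =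
  cong (X (suc K) i j 1 +_) (trans (+-identityʳ _) (trans (+-identityʳ _) (growth-one X K 1 (suc i) (suc j))))

-- `growth-transfer` is iterated until α = 1. Each use puts a new `R` innermost, and `R^-R` moves it
-- to the outside.
growth-R^ : ∀ s X K β → growth X K (suc s) (s + β) 0 0 ≡ Δ (R^ s X) K 0 0
growth-R^ zero    X K β = growth-one X K β 0 0
growth-R^ (suc s) X K β = trans (sym (growth-transfer X K 0 s (s + β) 0))
  (trans (growth-R^ s (R X) K β) (cong (λ Z → Δ Z K 0 0) (R^-R s X)))

swap : Functional → Functional
swap X K i j d = X K j i d

L : Functional → Functional
L X = swap (R (swap X))

L^ : ℕ → Functional → Functional
L^ zero    X = X
L^ (suc s) X = L (L^ s X)

L^-L : ∀ s X → L^ s (L X) ≡ L (L^ s X)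
L^-L zero    X = refl
L^-L (suc s) X = cong L (L^-L s X)

Δ-cong : ∀ {X Y} → X ≗₄ Y → ∀ K i j → Δ X K i j ≡ Δ Y K i j
Δ-cong p zero    i j = p 0 i j 1
Δ-cong p (suc K) i j = cong₂ _+_ (p (suc K) i j 1) (Δ-cong p K (suc i) (suc j))

Δ-swap : ∀ X K i j → Δ (swap X) K i j ≡ Δ X K j i
Δ-swap X zero    i j = refl
Δ-swap X (suc K) i j = cong (X (suc K) j i 1 +_) (Δ-swap X K (suc i) (suc j))

-- Multiplication by t, seen from the functional.
shift : (ℕ → ℕ) → ℕ → ℕ
shift f zero    = 0
shift f (suc K) = f K

-- The chain `Δ` is the tree with α = 1, and this is the functional equation of `growth-valley` for
-- it.
Δ-valley : ∀ X K l i j →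
  Δ (valleyₗ X l) K (suc i) j ≡ Δ (valleyₗ X l) K i j + Δ X K (suc (i + l)) j + shift (λ K → Δ (valleyₗ X (suc l)) K (suc i) j) K
Δ-valley X zero    l i j = sym (+-identityʳ _)
Δ-valley X (suc K) l i j rewrite Δ-valley X K l (suc i) (suc j) =
  trans (shuffle (valley X (suc K) i l j 1) _ _ _ _ _) (cong (valley X (suc K) i l j 1 + Δ (valleyₗ X l) K (suc i) (suc j) + Δ X (suc K) (suc (i + l)) j +_) (last K))
  where
  shuffle : ∀ a b c x y z → (a + b + c) + (x + y + z) ≡ a + x + (b + y) + (c + z)
  shuffle = solve-∀
  last : ∀ K → valley X K (suc i) (suc l) j 1 + shift (λ K → Δ (valleyₗ X (suc l)) K (suc (suc i)) (suc j)) K ≡ Δ (valleyₗ X (suc l)) K (suc i) j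
  last zero    = +-identityʳ _
  last (suc K) = refl

-- The recursion E = q² + (t u + t Y) E + q t u Y Σ_m (t u Y)^m, symmetric in u and Y, satisfied by ρ(q Σ_m (t u Y)^m).
E : Functional → ℕ → ℕ → ℕ → ℕ
E X zero    i j = X 0 i j 2
E X (suc K) i j = X (suc K) i j 2 + (E X K (suc i) j + E X K i (suc j)) + Δ X K (suc i) (suc j)

-- After the first term of the chain is split off, `Δ-valley` expands the rest. The t u ρ(1) of the
-- first term and the shifted term regroup into the same series with one more u, and the term with
-- exponent 0 of u is the same series with one more Y.
Δ-R : ∀ X K l j → Δ (valleyₗ X l) K 0 j ≡ E X K l j
Δ-R X zero    l j = refl
Δ-R X (suc K) l j rewrite Δ-valley X K l 0 (suc j) =
  trans (shuffle (X (suc K) l j 2) (valley X K 0 (suc l) j 1) _ _ _)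
    (cong (λ z → X (suc K) l j 2 + z + Δ X K (suc l) (suc j))
      (cong₂ _+_ (trans (last K) (Δ-R X K (suc l) j)) (Δ-R X K l (suc j))))
  where
  shuffle : ∀ x p a b c → x + p + (a + b + c) ≡ x + (p + c + a) + b
  shuffle = solve-∀
  last : ∀ K → valley X K 0 (suc l) j 1 + shift (λ K → Δ (valleyₗ X (suc l)) K 1 (suc j)) K ≡ Δ (valleyₗ X (suc l)) K 0 j
  last zero    = +-identityʳ _
  last (suc K) = refl

E-swap : ∀ X K i j → E (swap X) K i j ≡ E X K j i
E-swap X zero    i j = refl
E-swap X (suc K) i j = cong₂ _+_
  (cong (X (suc K) j i 2 +_) (trans (+-comm (E (swap X) K (suc i) j) _) (cong₂ _+_ (E-swap X K i (suc j)) (E-swap X K (suc i) j))))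
  (Δ-swap X K (suc i) (suc j))

-- The recursion `E` is symmetric in u and Y, so ρ and its analogue for Y agree on q Σ_m (t u Y)^m.
Δ-R-L : ∀ X K → Δ (R X) K 0 0 ≡ Δ (L X) K 0 0
Δ-R-L X K = begin
  Δ (R X) K 0 0        ≡⟨ Δ-R X K 0 0 ⟩
  E X K 0 0            ≡⟨ E-swap X K 0 0 ⟨
  E (swap X) K 0 0     ≡⟨ Δ-R (swap X) K 0 0 ⟨
  Δ (R (swap X)) K 0 0 ≡⟨ Δ-swap (R (swap X)) K 0 0 ⟨
  Δ (L X) K 0 0        ∎
  where open ≡-Reasoning

-- ρ acts neither on Y nor, beyond one factor q, on q. Hence the exponent of Y may differ on the two
-- sides, and that of q may be reindexed by any `e` that commutes with `suc`.
valley-cong : ∀ {X Y j j′} (e : ℕ → ℕ) → (∀ K i d → X K i j d ≡ Y K i j′ (e d)) → (∀ d → e (suc d) ≡ suc (e d)) →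
  ∀ K i l d → valley X K i l j d ≡ valley Y K i l j′ (e d)
valley-cong {Y = Y} {j′ = j′} e p q zero    zero    l d = trans (p 0 l (suc d)) (cong (Y 0 l j′) (q d))
valley-cong e p q zero    (suc i) l d = cong₂ _+_ (valley-cong e p q zero i l d) (p 0 _ d)
valley-cong {Y = Y} {j′ = j′} e p q (suc K) zero    l d = cong₂ _+_ (trans (p (suc K) l (suc d)) (cong (Y (suc K) l j′) (q d))) (valley-cong e p q K zero (suc l) d)
valley-cong e p q (suc K) (suc i) l d = cong₂ _+_ (cong₂ _+_ (valley-cong e p q (suc K) i l d) (p (suc K) _ d)) (valley-cong e p q K (suc i) (suc l) d)

valley-≗ : ∀ {X Y j j′} → (∀ K i d → X K i j d ≡ Y K i j′ d) → ∀ K i l d → valley X K i l j d ≡ valley Y K i l j′ d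
valley-≗ p = valley-cong (λ d → d) p (λ _ → refl)

R-cong : ∀ {X Y} → X ≗₄ Y → R X ≗₄ R Y
R-cong p K i j d = valley-≗ (λ K i d → p K i j d) K i 0 d

valley-+ : ∀ X Y K i l j d → valley (λ K i j d → X K i j d + Y K i j d) K i l j d ≡ valley X K i l j d + valley Y K i l j d
valley-+ X Y zero    zero    l j d = refl
valley-+ X Y zero    (suc i) l j d = trans (cong (_+ (X 0 (suc (i + l)) j d + Y 0 (suc (i + l)) j d)) (valley-+ X Y zero i l j d))
  (interchange (valley X zero i l j d) (valley Y zero i l j d) (X 0 (suc (i + l)) j d) (Y 0 (suc (i + l)) j d))
valley-+ X Y (suc K) zero    l j d = trans (cong (X (suc K) l j (suc d) + Y (suc K) l j (suc d) +_) (valley-+ X Y K zero (suc l) j d))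
  (interchange (X (suc K) l j (suc d)) (Y (suc K) l j (suc d)) (valley X K zero (suc l) j d) (valley Y K zero (suc l) j d))
valley-+ X Y (suc K) (suc i) l j d = trans
  (cong₂ (λ a b → a + (x + y) + b) (valley-+ X Y (suc K) i l j d) (valley-+ X Y K (suc i) (suc l) j d))
  (shuffle (valley X (suc K) i l j d) (valley Y (suc K) i l j d) x y (valley X K (suc i) (suc l) j d) (valley Y K (suc i) (suc l) j d))
  where
  x = X (suc K) (suc (i + l)) j d
  y = Y (suc K) (suc (i + l)) j d
  shuffle : ∀ a b c x y z → (a + b) + (c + x) + (y + z) ≡ a + c + y + (b + x + z)
  shuffle = solve-∀

valley-shift : ∀ X K i l j d → valley (λ K i j d → shift (λ K → X K i j d) K) K i l j d ≡ shift (λ K → valley X K i l j d) K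
valley-shift X zero    zero    l j d = refl
valley-shift X zero    (suc i) l j d = trans (+-identityʳ _) (valley-shift X zero i l j d)
valley-shift X (suc K) zero    l j d = trans (cong (X K l j (suc d) +_) (valley-shift X K zero (suc l) j d)) (last K)
  where
  last : ∀ K → X K l j (suc d) + shift (λ K → valley X K zero (suc l) j d) K ≡ valley X K zero l j d
  last zero    = +-identityʳ _
  last (suc K) = refl
valley-shift X (suc K) (suc i) l j d = trans
  (cong₂ (λ a b → a + X K (suc (i + l)) j d + b) (valley-shift X (suc K) i l j d) (valley-shift X K (suc i) (suc l) j d)) (last K)
  where
  last : ∀ K → valley X K i l j d + X K (suc (i + l)) j d + shift (λ K → valley X K (suc i) (suc l) j d) K ≡ valley X K (suc i) l j d
  last zero    = +-identityʳ _
  last (suc K) = refl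

-- ρ commutes with its analogue for Y. The recursion of the latter is unfolded once by `split`; ρ
-- passes through its terms by linearity (`valley-+`) and by compatibility with t (`valley-shift`),
-- and the induction is on j and K.
valley-comm : ∀ X l l′ K i j d →
  valley (λ K i j d → valley (swap X) K j l′ i d) K i l j d ≡ valley (λ K j i d → valley X K i l j d) K j l′ i d
valley-comm X l l′ K i zero    d = begin
  valley (λ K i j d → valley (swap X) K j l′ i d) K i l 0 d
    ≡⟨ valley-≗ {Y = λ K i j d → Y₁ K i j d + shift (λ K → Y₂ K i j d) K} {j′ = 0} split K i l d ⟩
  valley (λ K i j d → Y₁ K i j d + shift (λ K → Y₂ K i j d) K) K i l 0 d
    ≡⟨ valley-+ Y₁ (λ K i j d → shift (λ K → Y₂ K i j d) K) K i l 0 d ⟩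
  valley Y₁ K i l 0 d + valley (λ K i j d → shift (λ K → Y₂ K i j d) K) K i l 0 d
    ≡⟨ cong₂ _+_ (valley-cong {Y = X} {j′ = l′} suc (λ _ _ _ → refl) (λ _ → refl) K i l d) (valley-shift Y₂ K i l 0 d) ⟩
  valley X K i l l′ (suc d) + shift (λ K → valley Y₂ K i l 0 d) K
    ≡⟨ last K ⟩
  valley (λ K j i d → valley X K i l j d) K 0 l′ i d ∎
  where
  open ≡-Reasoning
  Y₁ Y₂ : Functional
  Y₁ K i j d = X K i l′ (suc d)
  Y₂ K i j d = valley (swap X) K j (suc l′) i d
  split : ∀ K i d → valley (swap X) K 0 l′ i d ≡ Y₁ K i 0 d + shift (λ K → Y₂ K i 0 d) K
  split zero    i d = sym (+-identityʳ _)
  split (suc K) i d = refl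
  last : ∀ K → valley X K i l l′ (suc d) + shift (λ K → valley Y₂ K i l 0 d) K ≡ valley (λ K j i d → valley X K i l j d) K 0 l′ i d
  last zero    = +-identityʳ _
  last (suc K) = cong (valley X (suc K) i l l′ (suc d) +_) (valley-comm X l (suc l′) K i 0 d)
valley-comm X l l′ K i (suc j) d = begin
  valley (λ K i j d → valley (swap X) K j l′ i d) K i l (suc j) d
    ≡⟨ valley-≗ {Y = λ K i j d → Y₀ K i j d + Y₁ K i j d + shift (λ K → Y₂ K i j d) K} {j′ = j} split K i l d ⟩
  valley (λ K i j d → Y₀ K i j d + Y₁ K i j d + shift (λ K → Y₂ K i j d) K) K i l j d
    ≡⟨ trans (valley-+ (λ K i j d → Y₀ K i j d + Y₁ K i j d) (λ K i j d → shift (λ K → Y₂ K i j d) K) K i l j d)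
             (cong (_+ valley (λ K i j d → shift (λ K → Y₂ K i j d) K) K i l j d) (valley-+ Y₀ Y₁ K i l j d)) ⟩
  valley Y₀ K i l j d + valley Y₁ K i l j d + valley (λ K i j d → shift (λ K → Y₂ K i j d) K) K i l j d
    ≡⟨ cong₂ _+_ (cong (valley Y₀ K i l j d +_) (valley-≗ {Y = X} {j′ = suc (j + l′)} (λ _ _ _ → refl) K i l d)) (valley-shift Y₂ K i l j d) ⟩
  valley Y₀ K i l j d + valley X K i l (suc (j + l′)) d + shift (λ K → valley Y₂ K i l j d) K
    ≡⟨ last K ⟩
  valley (λ K j i d → valley X K i l j d) K (suc j) l′ i d ∎
  where
  open ≡-Reasoning
  Y₀ Y₁ Y₂ : Functional
  Y₀ K i j d = valley (swap X) K j l′ i d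
  Y₁ K i j d = X K i (suc (j + l′)) d
  Y₂ K i j d = valley (swap X) K (suc j) (suc l′) i d
  split : ∀ K i d → valley (swap X) K (suc j) l′ i d ≡ Y₀ K i j d + Y₁ K i j d + shift (λ K → Y₂ K i j d) K
  split zero    i d = sym (+-identityʳ _)
  split (suc K) i d = refl
  last : ∀ K → valley Y₀ K i l j d + valley X K i l (suc (j + l′)) d + shift (λ K → valley Y₂ K i l j d) K ≡ valley (λ K j i d → valley X K i l j d) K (suc j) l′ i d
  last zero    = trans (+-identityʳ _) (cong (_+ valley X 0 i l (suc (j + l′)) d) (valley-comm X l l′ zero i j d))
  last (suc K) = cong₂ (λ a b → a + valley X (suc K) i l (suc (j + l′)) d + b) (valley-comm X l l′ (suc K) i j d)
    (trans (valley-≗ {X = Y₂} {Y = λ K i j d → valley (swap X) K j (suc l′) i d} {j = j} {j′ = suc j} (λ _ _ _ → refl) K i l d) (valley-comm X l (suc l′) K i (suc j) d))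

R^-L : ∀ s X → R^ s (L X) ≗₄ L (R^ s X)
R^-L zero    X K i j d = refl
R^-L (suc s) X K i j d = trans (R-cong (R^-L s X) K i j d) (valley-comm (R^ s X) 0 0 K i j d)

R^-swap : ∀ s X → R^ s (swap X) ≗₄ swap (L^ s X)
R^-swap zero    X K i j d = refl
R^-swap (suc s) X K i j d = R-cong (R^-swap s X) K i j d

-- The outermost `R` is exchanged for `L` on the chain, this `L` commutes past the other `R`s, and
-- the induction hypothesis applies to `L X`.
Δ-R^-L^ : ∀ s X K → Δ (R^ s X) K 0 0 ≡ Δ (L^ s X) K 0 0
Δ-R^-L^ zero    X K = refl
Δ-R^-L^ (suc s) X K = begin
  Δ (R (R^ s X)) K 0 0 ≡⟨ Δ-R-L (R^ s X) K ⟩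
  Δ (L (R^ s X)) K 0 0 ≡⟨ Δ-cong (R^-L s X) K 0 0 ⟨
  Δ (R^ s (L X)) K 0 0 ≡⟨ Δ-R^-L^ s (L X) K ⟩
  Δ (L^ s (L X)) K 0 0 ≡⟨ cong (λ Z → Δ Z K 0 0) (L^-L s X) ⟩
  Δ (L^ (suc s) X) K 0 0 ∎
  where open ≡-Reasoning

Δ-R^-swap : ∀ s X K → Δ (R^ s (swap X)) K 0 0 ≡ Δ (R^ s X) K 0 0
Δ-R^-swap s X K = begin
  Δ (R^ s (swap X)) K 0 0 ≡⟨ Δ-cong (R^-swap s X) K 0 0 ⟩
  Δ (swap (L^ s X)) K 0 0 ≡⟨ Δ-swap (L^ s X) K 0 0 ⟩
  Δ (L^ s X) K 0 0        ≡⟨ Δ-R^-L^ s X K ⟨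
  Δ (R^ s X) K 0 0        ∎
  where open ≡-Reasoning

-- The explicit formula for ρ.

-- The action of u^l φ^β, by φ^β = 1 + t u (φ + φ² + … + φ^β).
inBlock : Functional → ℕ → ℕ → ℕ → ℕ → ℕ → ℕ
inBlock X zero    β l j d = X 0 l j d
inBlock X (suc K) β l j d = X (suc K) l j d + ∑ β (λ b → inBlock X K (suc b) (suc l) j d)

-- The relation φ = 1 + t u φ, multiplied by φ^β.
inBlock-suc : ∀ X K β l j d → inBlock X (suc K) (suc β) l j d ≡ inBlock X (suc K) β l j d + inBlock X K (suc β) (suc l) j d
inBlock-suc X K β l j d = trans (cong (X (suc K) l j d +_) (∑-last β (λ b → inBlock X K (suc b) (suc l) j d))) (sym (+-assoc (X (suc K) l j d) _ _))

-- Sums over the new maxima: the i+1 possible rises D = c+1, …, c+i+1 leave the heights i, …, 1, 0,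
-- and the last one, h₀, makes the new entry high.
fall : (ℕ → ℕ → ℕ) → (ℕ → ℕ) → ℕ → ℕ → ℕ
fall h h₀ c zero    = h₀ (suc c)
fall h h₀ c (suc i) = h (suc i) (suc c) + fall h h₀ (suc c) i

fall-cong : ∀ {h h₀ g g₀} → (∀ i D → h i D ≡ g i D) → (∀ D → h₀ D ≡ g₀ D) → ∀ c i → fall h h₀ c i ≡ fall g g₀ c i
fall-cong p q c zero    = q (suc c)
fall-cong p q c (suc i) = cong₂ _+_ (p (suc i) (suc c)) (fall-cong p q (suc c) i)

fall-zero : ∀ {h h₀} → (∀ i D → h i D ≡ 0) → (∀ D → h₀ D ≡ 0) → ∀ c i → fall h h₀ c i ≡ 0
fall-zero p q c zero    = q (suc c)
fall-zero p q c (suc i) = cong₂ _+_ (p (suc i) (suc c)) (fall-zero p q (suc c) i)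

-- The action of u^l φ^c ρ(u^i), from the explicit formula for ρ(u^i).
valleySum : Functional → ℕ → ℕ → ℕ → ℕ → ℕ → ℕ → ℕ
valleySum X K c i l j d = fall (λ i D → inBlock X K D (i + l) j d) (λ D → inBlock X K D l j (suc d)) c i

-- With no power of t left, φ acts as 1, and so does any power of it.
valleySum-zero : ∀ X c i l j d → valleySum X 0 (suc c) i l j d ≡ valleySum X 0 c i l j d
valleySum-zero X c zero    l j d = refl
valleySum-zero X c (suc i) l j d = cong (X 0 (suc i + l) j d +_) (valleySum-zero X (suc c) i l j d)

valleySum-suc : ∀ X K c i l j d → valleySum X (suc K) (suc c) i l j d ≡ valleySum X (suc K) c i l j d + valleySum X K (suc c) i (suc l) j d
valleySum-suc X K c zero    l j d = inBlock-suc X K (suc c) l j (suc d)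
valleySum-suc X K c (suc i) l j d = trans
  (cong₂ _+_ (trans (inBlock-suc X K (suc c) (suc i + l) j d)
               (cong (λ z → inBlock X (suc K) (suc c) (suc i + l) j d + inBlock X K (suc (suc c)) z j d) (sym (+-suc (suc i) l))))
             (valleySum-suc X K (suc c) i l j d))
  (interchange (inBlock X (suc K) (suc c) (suc i + l) j d) _ _ _)

-- The explicit formula reads ρ(u^{i+1}) = u^{i+1} φ + φ ρ(u^i). Replacing the outer φ of both terms
-- by 1 + t u φ gives back the recursion that defines `valley`.
valley≡valleySum : ∀ X K i l j d → valley X K i l j d ≡ valleySum X K 0 i l j d
valley≡valleySum X zero    zero    l j d = refl
valley≡valleySum X zero    (suc i) l j d = trans (+-comm (valley X 0 i l j d) _)
  (cong (X 0 (suc (i + l)) j d +_) (trans (valley≡valleySum X zero i l j d) (sym (valleySum-zero X 0 i l j d))))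
valley≡valleySum X (suc K) zero    l j d = trans (cong (X (suc K) l j (suc d) +_) (valley≡valleySum X K zero (suc l) j d))
  (cong (X (suc K) l j (suc d) +_) (sym (+-identityʳ _)))
valley≡valleySum X (suc K) (suc i) l j d = begin
  valley X (suc K) i l j d + x + valley X K (suc i) (suc l) j d
    ≡⟨ cong₂ (λ a b → a + x + b) (valley≡valleySum X (suc K) i l j d) (valley≡valleySum X K (suc i) (suc l) j d) ⟩
  valleySum X (suc K) 0 i l j d + x + (inBlock X K 1 (suc i + suc l) j d + valleySum X K 1 i (suc l) j d)
    ≡⟨ shuffle (valleySum X (suc K) 0 i l j d) x _ _ ⟩
  x + inBlock X K 1 (suc i + suc l) j d + (valleySum X (suc K) 0 i l j d + valleySum X K 1 i (suc l) j d)
    ≡⟨ cong₂ _+_ (cong (x +_) (trans (cong (λ z → inBlock X K 1 z j d) (+-suc (suc i) l)) (sym (+-identityʳ _)))) (sym (valleySum-suc X K 0 i l j d)) ⟩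
  inBlock X (suc K) 1 (suc i + l) j d + valleySum X (suc K) 1 i l j d ∎
  where
  open ≡-Reasoning
  x = X (suc K) (suc (i + l)) j d
  shuffle : ∀ a x b c → a + x + (b + c) ≡ x + b + (a + c)
  shuffle = solve-∀

-- The generating tree of the three classes.

-- N j r i β b d counts the extensions by r entries of a sequence with j+1 zeros, b left-to-right maxima,
-- d high entries and n − max = i+1, when β values are admissible for the next entry of the current block;
-- M r j does so for the sequence 0^{j+1}.
module Tree (F : ℕ → ℕ → ℕ → ℕ → ℕ) where

  N : ℕ → ℕ → ℕ → ℕ → ℕ → ℕ → ℕ
  N j zero    i β b d = F j i b d
  N j (suc r) i β b d = ∑ β (λ β′ → N j r (suc i) (suc β′) b d) +
    fall (λ i D → N j r i D (suc b) d) (λ D → N j r 0 D (suc b) (suc d)) 0 i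

  M : ℕ → ℕ → ℕ
  M zero    j = F j j 1 1
  M (suc r) j = M r (suc j) + fall (λ i D → N j r i D 2 1) (λ D → N j r 0 D 2 2) 0 j

  module _ (q : ℕ) (F-off : ∀ j i b d → b ≢ q → F j i b d ≡ 0) where

    -- The number b of left-to-right maxima never decreases along the tree.
    N-high : ∀ j r i β b d → q < b → N j r i β b d ≡ 0
    N-high j zero    i β b d lt = F-off j i b d (>⇒≢ lt)
    N-high j (suc r) i β b d lt = cong₂ _+_
      (trans (∑-cong β (λ β′ → N-high j r (suc i) (suc β′) b d lt)) (∑-zero β))
      (fall-zero (λ i D → N-high j r i D (suc b) d (m<n⇒m<1+n lt)) (λ D → N-high j r 0 D (suc b) (suc d) (m<n⇒m<1+n lt)) 0 i)

    -- Each of the r remaining entries raises b by at most one.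
    N-low : ∀ j r i β b d → r + b < q → N j r i β b d ≡ 0
    N-low j zero    i β b d lt = F-off j i b d (<⇒≢ lt)
    N-low j (suc r) i β b d lt = cong₂ _+_
      (trans (∑-cong β (λ β′ → N-low j r (suc i) (suc β′) b d (<-trans (n<1+n _) lt))) (∑-zero β))
      (fall-zero (λ i D → N-low j r i D (suc b) d lt′) (λ D → N-low j r 0 D (suc b) (suc d) lt′) 0 i)
      where
      lt′ : r + suc b < q
      lt′ = subst (_< q) (sym (+-suc r b)) lt

    M-high : ∀ r j → q ≡ 0 → M r j ≡ 0
    M-high zero    j refl = F-off j j 1 1 (λ ())
    M-high (suc r) j refl = cong₂ _+_ (M-high r (suc j) refl)
      (fall-zero (λ i D → N-high j r i D 2 1 (s≤s z≤n)) (λ D → N-high j r 0 D 2 2 (s≤s z≤n)) 0 j)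

    M-low : ∀ r j → r + 1 < q → M r j ≡ 0
    M-low zero    j lt = F-off j j 1 1 (<⇒≢ lt)
    M-low (suc r) j lt = cong₂ _+_ (M-low r (suc j) (<-trans (n<1+n _) lt))
      (fall-zero (λ i D → N-low j r i D 2 1 lt′) (λ D → N-low j r 0 D 2 2 lt′) 0 j)
      where
      lt′ : r + 2 < q
      lt′ = subst (_< q) (sym (+-suc r 1)) lt

    module _ (X : Functional) (X-zero : ∀ i j d → F j i q d ≡ X 0 i j d) (X-suc : ∀ K i j d → X (suc K) i j d ≡ 0) where

      -- If all blocks opened now contribute powers u^i φ^D, the choice of the new maximum sums them
      -- to the explicit formula for ρ(u^i); the factor q belongs to the high choice.
      N-newmax : ∀ j r s K i b d → (∀ i β d → N j r i β (suc b) d ≡ inBlock (R^ s X) K β i j d) →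
        fall (λ i D → N j r i D (suc b) d) (λ D → N j r 0 D (suc b) (suc d)) 0 i ≡ R^ (suc s) X K i j d
      N-newmax j r s K i b d p = trans
        (fall-cong (λ i D → trans (p i D d) (cong (λ z → inBlock (R^ s X) K D z j d) (sym (+-identityʳ i)))) (λ D → p 0 D (suc d)) 0 i)
        (sym (valley≡valleySum (R^ s X) K i 0 j d))

      -- Of the K + s entries to come, s open a block and cost one `R` each, while K continue a
      -- block and cost one t each. For s = 0 or K = 0 one of the two branches dies by `N-high` or
      -- `N-low`.
      N≡inBlock : ∀ j K s i β b d → b + s ≡ q → N j (K + s) i β b d ≡ inBlock (R^ s X) K β i j d
      N≡inBlock j zero    zero    i β b d refl rewrite +-identityʳ b = X-zero i j d
      N≡inBlock j (suc K) zero    i β b d e = begin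
        ∑ β (λ β′ → N j (K + 0) (suc i) (suc β′) b d) + _
          ≡⟨ cong₂ _+_ (∑-cong β (λ β′ → N≡inBlock j K 0 (suc i) (suc β′) b d e))
               (fall-zero (λ i D → N-high j (K + 0) i D (suc b) d lt) (λ D → N-high j (K + 0) 0 D (suc b) (suc d) lt) 0 i) ⟩
        ∑ β (λ β′ → inBlock X K (suc β′) (suc i) j d) + 0
          ≡⟨ +-comm _ 0 ⟩
        ∑ β (λ β′ → inBlock X K (suc β′) (suc i) j d)
          ≡⟨ cong (_+ ∑ β (λ β′ → inBlock X K (suc β′) (suc i) j d)) (sym (X-suc K i j d)) ⟩
        inBlock X (suc K) β i j d ∎
        where
        open ≡-Reasoning
        lt : q < suc b
        lt = s≤s (≤-reflexive (trans (sym e) (+-identityʳ b)))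
      N≡inBlock j zero    (suc s) i β b d e = cong₂ _+_
        (trans (∑-cong β (λ β′ → N-low j s (suc i) (suc β′) b d lt)) (∑-zero β))
        (N-newmax j s s 0 i b d (λ i β d → N≡inBlock j 0 s i β (suc b) d (trans (sym (+-suc b s)) e)))
        where
        lt : s + b < q
        lt = subst (suc (s + b) ≤_) (trans (cong suc (+-comm s b)) (trans (sym (+-suc b s)) e)) ≤-refl
      N≡inBlock j (suc K) (suc s) i β b d e = trans (+-comm (∑ β (λ β′ → N j (K + suc s) (suc i) (suc β′) b d)) _)
        (cong₂ _+_
          (N-newmax j (K + suc s) s (suc K) i b d
            (λ i β d → trans (cong (λ r → N j r i β (suc b) d) (+-suc K s)) (N≡inBlock j (suc K) s i β (suc b) d (trans (sym (+-suc b s)) e))))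
          (∑-cong β (λ β′ → N≡inBlock j K (suc s) (suc i) (suc β′) b d e)))

      -- The word 0^{j+1} carries u^j Y^j q. One more zero multiplies this by t u Y, which is a step
      -- of the chain `Δ`; the first positive entry applies the first ρ.
      M≡Δ : ∀ K s j → suc s ≡ q → M (K + s) j ≡ Δ (R^ s X) K j j
      M≡Δ zero    zero    j refl = X-zero j j 1
      M≡Δ (suc K) zero    j refl = trans (cong₂ _+_ (M≡Δ K 0 (suc j) refl)
          (fall-zero (λ i D → N-high j (K + 0) i D 2 1 ≤-refl) (λ D → N-high j (K + 0) 0 D 2 2 ≤-refl) 0 j))
        (trans (+-comm _ 0) (cong (_+ Δ X K (suc j) (suc j)) (sym (X-suc K j j 1))))
      M≡Δ zero    (suc s) j refl = cong₂ _+_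
        (M-low s (suc j) (s≤s (≤-reflexive (+-comm s 1))))
        (N-newmax j s s 0 j 1 1 (λ i β d → N≡inBlock j 0 s i β 2 d refl))
      M≡Δ (suc K) (suc s) j refl = trans (+-comm (M (K + suc s) (suc j)) _) (cong₂ _+_
        (N-newmax j (K + suc s) s (suc K) j 1 1
            (λ i β d → trans (cong (λ r → N j r i β 2 d) (+-suc K s)) (N≡inBlock j (suc K) s i β 2 d refl)))
        (M≡Δ K (suc s) (suc j) refl))

-- Patterns and subsequences

∧-true : ∀ {a b} → a ∧ b ≡ true → a ≡ true × b ≡ true
∧-true {true} {true} refl = refl , refl

⇔ᵇ-≡ : ∀ {a b} → (a ⇔ᵇ b) ≡ true → a ≡ b
⇔ᵇ-≡ {true}  {true}  _ = refl
⇔ᵇ-≡ {false} {false} _ = refl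

<⇒<ᵇ≡ : ∀ {m n} → m < n → (m <ᵇ n) ≡ true
<⇒<ᵇ≡ {zero}  {suc n} _       = refl
<⇒<ᵇ≡ {suc m} {suc n} (s≤s p) = <⇒<ᵇ≡ p

≥⇒<ᵇ≡ : ∀ {m n} → n ≤ m → (m <ᵇ n) ≡ false
≥⇒<ᵇ≡ {m}     {zero}  _       = refl
≥⇒<ᵇ≡ {suc m} {suc n} (s≤s p) = ≥⇒<ᵇ≡ p

<ᵇ≡⇒< : ∀ {m n} → (m <ᵇ n) ≡ true → m < n
<ᵇ≡⇒< {m} {n} p = <ᵇ⇒< m n (subst T (sym p) _)

≡ᵇ-refl : ∀ n → (n ≡ᵇ n) ≡ true
≡ᵇ-refl zero    = refl
≡ᵇ-refl (suc n) = ≡ᵇ-refl n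

≡ᵇ≡⇒≡ : ∀ {m n} → (m ≡ᵇ n) ≡ true → m ≡ n
≡ᵇ≡⇒≡ {m} {n} p = ≡ᵇ⇒≡ m n (subst T (sym p) _)

≢⇒≡ᵇ≡ : ∀ {m n} → m ≢ n → (m ≡ᵇ n) ≡ false
≢⇒≡ᵇ≡ ne = ¬-not (λ p → ne (≡ᵇ≡⇒≡ p))

-- Rel a b x y says that x, y compare like the pattern letters a, b; it computes on literals.
Rel : ℕ → ℕ → ℕ → ℕ → Set
Rel zero    zero    x y = x ≡ y
Rel zero    (suc b) x y = x < y
Rel (suc a) zero    x y = y < x
Rel (suc a) (suc b) x y = Rel a b x y

cmp : ℕ → ℕ → ℕ → ℕ → Bool
cmp a b x y = ((x <ᵇ y) ⇔ᵇ (a <ᵇ b)) ∧ ((x ≡ᵇ y) ⇔ᵇ (a ≡ᵇ b))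

Rel⇒cmp : ∀ a b {x y} → Rel a b x y → cmp a b x y ≡ true
Rel⇒cmp zero    zero    {x} refl rewrite ≡ᵇ-refl x | ≥⇒<ᵇ≡ (≤-refl {x}) = refl
Rel⇒cmp zero    (suc b) p rewrite <⇒<ᵇ≡ p | ≢⇒≡ᵇ≡ (<⇒≢ p) = refl
Rel⇒cmp (suc a) zero    p rewrite ≥⇒<ᵇ≡ (<⇒≤ p) | ≢⇒≡ᵇ≡ (>⇒≢ p) = refl
Rel⇒cmp (suc a) (suc b) p = Rel⇒cmp a b p

cmp⇒Rel : ∀ a b {x y} → cmp a b x y ≡ true → Rel a b x y
cmp⇒Rel zero    zero    p = ≡ᵇ≡⇒≡ (⇔ᵇ-≡ (proj₂ (∧-true p)))
cmp⇒Rel zero    (suc b) p = <ᵇ≡⇒< (⇔ᵇ-≡ (proj₁ (∧-true p)))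
cmp⇒Rel (suc a) zero {x} {y} p with <-cmp x y | ∧-true p
... | tri< lt _ _ | q , _ with () ← trans (sym (<⇒<ᵇ≡ lt)) (⇔ᵇ-≡ q)
... | tri≈ _ refl _ | _ , q with () ← trans (sym (≡ᵇ-refl x)) (⇔ᵇ-≡ q)
... | tri> _ _ gt | _ = gt
cmp⇒Rel (suc a) (suc b) p = cmp⇒Rel a b p

Rel-sym : ∀ a b {x y} → Rel a b x y → Rel b a y x
Rel-sym zero    zero    p = sym p
Rel-sym zero    (suc b) p = p
Rel-sym (suc a) zero    p = p
Rel-sym (suc a) (suc b) p = Rel-sym a b p

Rel-refl : ∀ a {x} → Rel a a x x
Rel-refl zero    = refl
Rel-refl (suc a) = Rel-refl a

Occurs : ℕ → ℕ → ℕ → ℕ → ℕ → ℕ → Set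
Occurs a b c x y z = Rel a b x y × Rel a c x z × Rel b c y z

orderIso⁺ : ∀ a b c {x y z} → Occurs a b c x y z → orderIso (x ∷ y ∷ z ∷ []) (a ∷ b ∷ c ∷ []) ≡ true
orderIso⁺ a b c {x} {y} {z} (p , q , r)
  rewrite Rel⇒cmp a a (Rel-refl a {x}) | Rel⇒cmp b b (Rel-refl b {y}) | Rel⇒cmp c c (Rel-refl c {z})
        | Rel⇒cmp a b p | Rel⇒cmp a c q | Rel⇒cmp b c r
        | Rel⇒cmp b a (Rel-sym a b p) | Rel⇒cmp c a (Rel-sym a c q) | Rel⇒cmp c b (Rel-sym b c r) = refl

-- Reads the three comparisons above the diagonal off the 3 × 3 table evaluated by `orderIso`; `v`
-- and `w` stand for its last row.
rows : ∀ p q r s t u v w → (p ∧ (q ∧ (r ∧ true))) ∧ ((s ∧ (t ∧ (u ∧ true))) ∧ (v ∧ w)) ≡ true → q ≡ true × r ≡ true × u ≡ true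
rows true true true true true true v w p = refl , refl , refl

orderIso⁻ : ∀ a b c s → orderIso s (a ∷ b ∷ c ∷ []) ≡ true →
  ∃[ x ] ∃[ y ] ∃[ z ] s ≡ x ∷ y ∷ z ∷ [] × Occurs a b c x y z
orderIso⁻ a b c (x ∷ y ∷ z ∷ []) p
  with rows (cmp a a x x) (cmp a b x y) (cmp a c x z) (cmp b a y x) (cmp b b y y) (cmp b c y z)
            (cmp c a z x ∧ (cmp c b z y ∧ (cmp c c z z ∧ true))) true p
... | q , r , t = x , y , z , refl , cmp⇒Rel a b q , cmp⇒Rel a c r , cmp⇒Rel b c t

any⁺ : ∀ {A : Set} (p : A → Bool) {x xs} → x ∈ xs → p x ≡ true → any p xs ≡ true
any⁺ p (here refl) q rewrite q = refl
any⁺ p {xs = y ∷ ys} (there i) q with p y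
... | true  = refl
... | false = any⁺ p i q

any⁻ : ∀ {A : Set} (p : A → Bool) xs → any p xs ≡ true → ∃[ x ] x ∈ xs × p x ≡ true
any⁻ p (x ∷ xs) q with p x in eq
... | true  = x , here refl , eq
... | false with any⁻ p xs q
...   | y , i , r = y , there i , r

∈-subseqs⁺ : ∀ {s e} → s ⊆ e → s ∈ subseqs e
∈-subseqs⁺ []         = here refl
∈-subseqs⁺ {e = y ∷ e} (_ ∷ʳ p)   = ∈-++⁺ʳ (map (y ∷_) (subseqs e)) (∈-subseqs⁺ p)
∈-subseqs⁺ (refl ∷ p) = ∈-++⁺ˡ (∈-map⁺ _ (∈-subseqs⁺ p))

∈-subseqs⁻ : ∀ {s} e → s ∈ subseqs e → s ⊆ e
∈-subseqs⁻ []      (here refl) = []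
∈-subseqs⁻ (y ∷ e) i with ∈-++⁻ (map (y ∷_) (subseqs e)) i
... | inj₂ j = y ∷ʳ ∈-subseqs⁻ e j
... | inj₁ j with ∈-map⁻ (y ∷_) j
...   | s , k , refl = refl ∷ ∈-subseqs⁻ e k

contains⁺ : ∀ a b c e {x y z} → (x ∷ y ∷ z ∷ []) ⊆ e → Occurs a b c x y z → contains e (a ∷ b ∷ c ∷ []) ≡ true
contains⁺ a b c e p o = any⁺ _ (∈-subseqs⁺ p) (orderIso⁺ a b c o)

contains⁻ : ∀ a b c e → contains e (a ∷ b ∷ c ∷ []) ≡ true →
  ∃[ x ] ∃[ y ] ∃[ z ] (x ∷ y ∷ z ∷ []) ⊆ e × Occurs a b c x y z
contains⁻ a b c e p with any⁻ _ (subseqs e) p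
... | s , i , q with orderIso⁻ a b c s q
...   | x , y , z , refl , o = x , y , z , ∈-subseqs⁻ e i , o

contains-mono : ∀ e e′ f → e ⊆ e′ → contains e f ≡ true → contains e′ f ≡ true
contains-mono e e′ f p q with any⁻ _ (subseqs e) q
... | s , i , r = any⁺ _ (∈-subseqs⁺ (⊆-trans (∈-subseqs⁻ e i) p)) r

Avoids : List (List ℕ) → List ℕ → Set
Avoids T e = All (λ f → contains e f ≡ false) T

avoidsAll⁺ : ∀ T e → Avoids T e → avoidsAll T e ≡ true
avoidsAll⁺ []      e []       = refl
avoidsAll⁺ (f ∷ T) e (p ∷ ps) rewrite p = avoidsAll⁺ T e ps

avoidsAll⁻ : ∀ T e → avoidsAll T e ≡ true → Avoids T e
avoidsAll⁻ []      e p = []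
avoidsAll⁻ (f ∷ T) e p with contains e f in eq
... | false = eq ∷ avoidsAll⁻ T e p

¬avoidsAll : ∀ T e f → f ∈ T → contains e f ≡ true → avoidsAll T e ≡ false
¬avoidsAll (f ∷ T) e .f (here refl) q rewrite q = refl
¬avoidsAll (g ∷ T) e f (there i) q with contains e g
... | true  = refl
... | false = ¬avoidsAll T e f i q

avoidsAll-anti : ∀ T e e′ → e ⊆ e′ → avoidsAll T e ≡ false → avoidsAll T e′ ≡ false
avoidsAll-anti (f ∷ T) e e′ p q with contains e f in eq
... | true  = ¬avoidsAll (f ∷ T) e′ f (here refl) (contains-mono e e′ f p eq)
... | false with contains e′ f
...   | true  = refl
...   | false = avoidsAll-anti T e e′ p q

⊆-snoc : ∀ (e : List ℕ) {k} → e ⊆ e ++ [ k ]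
⊆-snoc e = ++⁺ʳ [ _ ] ⊆-refl

snoc-⊆ : ∀ {s e : List ℕ} k → s ⊆ e → s ++ [ k ] ⊆ e ++ [ k ]
snoc-⊆ k p = ++⁺ p (refl ∷ [])

snoc-⊆⁻ : ∀ s e {z k : ℕ} → s ++ [ z ] ⊆ e ++ [ k ] → (s ++ [ z ] ⊆ e) ⊎ (s ⊆ e × z ≡ k)
snoc-⊆⁻ []      []      (refl ∷ p)        = inj₂ ([] , refl)
snoc-⊆⁻ (a ∷ []) [] (refl ∷ ())
snoc-⊆⁻ (a ∷ b ∷ s) [] (refl ∷ ())
snoc-⊆⁻ s       (y ∷ e) (_ ∷ʳ p)          = map-⊎ (y ∷ʳ_) (λ (q , eq) → y ∷ʳ q , eq) (snoc-⊆⁻ s e p)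
snoc-⊆⁻ []      (y ∷ e) (refl ∷ p)        = inj₁ (refl ∷ minimum e)
snoc-⊆⁻ (a ∷ s) (y ∷ e) (refl ∷ p)        = map-⊎ (refl ∷_) (λ (q , eq) → refl ∷ q , eq) (snoc-⊆⁻ s e p)

Elems : (ℕ → Set) → List ℕ → Set
Elems Q e = ∀ {x} → [ x ] ⊆ e → Q x

Pairs : (ℕ → ℕ → Set) → List ℕ → Set
Pairs Q e = ∀ {x y} → (x ∷ y ∷ []) ⊆ e → Q x y

Elems-snoc : ∀ {Q e k} → Elems Q e → Q k → Elems Q (e ++ [ k ])
Elems-snoc {e = e} p q i with snoc-⊆⁻ [] e i
... | inj₁ j          = p j
... | inj₂ (_ , refl) = q

Pairs-snoc : ∀ {Q : ℕ → ℕ → Set} {e k} → Pairs Q e → Elems (λ x → Q x k) e → Pairs Q (e ++ [ k ])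
Pairs-snoc {e = e} p q {x} i with snoc-⊆⁻ [ x ] e i
... | inj₁ j          = p j
... | inj₂ (j , refl) = q j

-- The entry k, appended to e, does not end an occurrence of the pattern. The default `⊥` confines
-- this to patterns of length three.
Quiet : List ℕ → ℕ → List ℕ → Set
Quiet e k (a ∷ b ∷ c ∷ []) = Pairs (λ x y → ¬ Occurs a b c x y k) e
Quiet e k _                = ⊥

Avoids-snoc : ∀ {T e k} → Avoids T e → All (Quiet e k) T → Avoids T (e ++ [ k ])
Avoids-snoc []       []       = []
Avoids-snoc {(a ∷ b ∷ c ∷ []) ∷ T} {e} {k} (p ∷ ps) (q ∷ qs) = ¬-not go ∷ Avoids-snoc ps qs
  where
  go : ¬ contains (e ++ [ k ]) (a ∷ b ∷ c ∷ []) ≡ true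
  go r with contains⁻ a b c (e ++ [ k ]) r
  ... | x , y , z , i , o with snoc-⊆⁻ (x ∷ y ∷ []) e i
  ...   | inj₂ (j , refl) = q j o
  ...   | inj₁ j with () ← trans (sym p) (contains⁺ a b c e j o)

blocked : ∀ {T e k x y} a b c → (a ∷ b ∷ c ∷ []) ∈ T → (x ∷ y ∷ []) ⊆ e → Occurs a b c x y k → avoidsAll T (e ++ [ k ]) ≡ false
blocked {T} {e} {k} a b c i p o = ¬avoidsAll T (e ++ [ k ]) (a ∷ b ∷ c ∷ []) i (contains⁺ a b c (e ++ [ k ]) (snoc-⊆ k p) o)

∑-cong< : ∀ n {f g : ℕ → ℕ} → (∀ i → i < n → f i ≡ g i) → ∑ n f ≡ ∑ n g
∑-cong< zero    p = refl
∑-cong< (suc n) p = cong₂ _+_ (p 0 (s≤s z≤n)) (∑-cong< n (λ i lt → p (suc i) (s≤s lt)))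

∑-zero< : ∀ n {f : ℕ → ℕ} → (∀ i → i < n → f i ≡ 0) → ∑ n f ≡ 0
∑-zero< n p = trans (∑-cong< n {g = λ _ → 0} p) (∑-zero n)

∑-split : ∀ m n f → ∑ (m + n) f ≡ ∑ m f + ∑ n (λ i → f (m + i))
∑-split zero    n f = refl
∑-split (suc m) n f = trans (cong (f 0 +_) (∑-split m n (λ i → f (suc i)))) (sym (+-assoc (f 0) _ _))

∑-reverse : ∀ n (f : ℕ → ℕ) → ∑ n (λ i → f (n ∸ i)) ≡ ∑ n (λ i → f (suc i))
∑-reverse zero    f = refl
∑-reverse (suc n) f = trans (cong (f (suc n) +_) (∑-reverse n f))
  (trans (+-comm (f (suc n)) (∑ n (λ i → f (suc i)))) (sym (∑-last n (λ i → f (suc i)))))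

-- The block structure of the three classes.

-- Good e lo hi β: e avoids T, its maximum is hi, its current block lies in [lo , hi], and the block can be
-- continued in β ways, which leave 1, 2, …, β ways respectively.
record Class (T : List (List ℕ)) : Set₁ where
  field
    Good : List ℕ → ℕ → ℕ → ℕ → Set
    start : Good [ 0 ] 0 0 1
    avoids : ∀ {e lo hi β} → Good e lo hi β → Avoids T e
    bound : ∀ {e lo hi β} → Good e lo hi β → Elems (_≤ hi) e
    hi∈ : ∀ {e lo hi β} → Good e lo hi β → [ hi ] ⊆ e
    again : ∀ {e} → Good e 0 0 1 → Good (e ++ [ 0 ]) 0 0 1
    new : ∀ {e lo hi β} t → Good e lo hi β → Good (e ++ [ suc hi + t ]) (suc hi) (suc hi + t) (suc t)
    -- Letters and labels match up in a different order in each class, so the condition compares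
    -- sums; forbidden letters are summed as 0.
    within : ∀ {e lo hi β} → Good e lo hi β → (g h : ℕ → ℕ) →
      (∀ k → avoidsAll T (e ++ [ k ]) ≡ false → g k ≡ 0) →
      (∀ k β′ → lo ≤ k → k ≤ hi → Good (e ++ [ k ]) lo hi β′ → g k ≡ h β′) →
      ∑ (suc hi) g ≡ ∑ β (λ b → h (suc b))

-- What the three classes share. `below` keeps the previous maximum lo - 1 followed by the current
-- one: with this pair a later entry equal to lo - 1 completes 010, and a smaller one completes 120.
record Core (T : List (List ℕ)) (e : List ℕ) (lo hi : ℕ) : Set where
  field
    core-avoids : Avoids T e
    core-bound : Elems (_≤ hi) e
    core-hi∈ : [ hi ] ⊆ e
    lo≤hi : lo ≤ hi
    below : ∀ m → lo ≡ suc m → (m ∷ hi ∷ []) ⊆ e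
open Core

Core-new : ∀ {T e lo hi} t → Core T e lo hi → All (Quiet e (suc hi + t)) T → Core T (e ++ [ suc hi + t ]) (suc hi) (suc hi + t)
Core-new {e = e} {hi = hi} t c q = record
  { core-avoids = Avoids-snoc (core-avoids c) q
  ; core-bound = Elems-snoc {λ x → x ≤ suc hi + t} {e} (λ i → ≤-trans (core-bound c i) (≤-trans (n≤1+n hi) (m≤m+n (suc hi) t))) ≤-refl
  ; core-hi∈ = snoc-⊆ _ (minimum e)
  ; lo≤hi = m≤m+n (suc hi) t
  ; below = λ { m refl → snoc-⊆ _ (core-hi∈ c) }
  }

Core-within : ∀ {T e lo hi k} → k ≤ hi → Core T e lo hi → All (Quiet e k) T → Core T (e ++ [ k ]) lo hi
Core-within {e = e} {hi = hi} {k} le c q = record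
  { core-avoids = Avoids-snoc (core-avoids c) q
  ; core-bound = Elems-snoc {λ x → x ≤ hi} {e} (core-bound c) le
  ; core-hi∈ = ⊆-trans (core-hi∈ c) (⊆-snoc e)
  ; lo≤hi = lo≤hi c
  ; below = λ m eq → ⊆-trans (below c m eq) (⊆-snoc e)
  }

fst⊆ : ∀ {x y : ℕ} {e} → (x ∷ y ∷ []) ⊆ e → [ x ] ⊆ e
fst⊆ p = ⊆-trans (refl ∷ (_ ∷ʳ [])) p

snd⊆ : ∀ {x y : ℕ} {e} → (x ∷ y ∷ []) ⊆ e → [ y ] ⊆ e
snd⊆ p = ⊆-trans (_ ∷ʳ (refl ∷ [])) p

below-blocked : ∀ {T e lo hi k} → (0 ∷ 1 ∷ 0 ∷ []) ∈ T → (1 ∷ 2 ∷ 0 ∷ []) ∈ T → Core T e lo hi → k < lo → avoidsAll T (e ++ [ k ]) ≡ false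
below-blocked {T} {lo = suc m} {hi} {k} i j c (s≤s k≤m) with m≤n⇒m<n∨m≡n k≤m
... | inj₁ k<m  = blocked {T} 1 2 0 j (below c m refl) (lo≤hi c , k<m , <-trans k<m (lo≤hi c))
... | inj₂ refl = blocked {T} 0 1 0 i (below c m refl) (lo≤hi c , refl , lo≤hi c)

∈₁ : ∀ {A : Set} {x : A} {xs} → x ∈ x ∷ xs
∈₁ = here refl

∈₃ : ∀ {A : Set} {x y z : A} {xs} → z ∈ x ∷ y ∷ z ∷ xs
∈₃ = there (there (here refl))

too-big : ∀ {e hi k x} → hi < k → Elems (_≤ hi) e → [ x ] ⊆ e → ¬ k ≤ x
too-big lt b i k≤x = <⇒≱ lt (≤-trans k≤x (b i))

Core-start : ∀ {T} → Avoids T [ 0 ] → Core T [ 0 ] 0 0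
Core-start p = record
  { core-avoids = p
  ; core-bound = λ { (refl ∷ []) → z≤n ; (_ ∷ʳ ()) }
  ; core-hi∈ = refl ∷ []
  ; lo≤hi = z≤n
  ; below = λ m () }

no-pair : ∀ {x y z : ℕ} → ¬ (x ∷ y ∷ []) ⊆ [ z ]
no-pair (_ ∷ʳ ())
no-pair (_ ∷ ())

module Decreasing where

  -- Within the current block the entries decrease weakly from hi to last.
  record Good (e : List ℕ) (lo hi β : ℕ) : Set where
    field
      last  : ℕ
      core  : Core T₁ e lo hi
      lo+β  : lo + β ≡ suc last
      lo≤   : lo ≤ last
      ≤hi   : last ≤ hi
      pairs : Pairs (λ x y → x < lo ⊎ (last ≤ y × y ≤ x)) e
      elems : Elems (λ x → x < lo ⊎ last ≤ x) e
      wit   : last ≡ hi ⊎ (hi ∷ last ∷ []) ⊆ e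

  -- In each pattern the last letter is at most the first, so an entry above all earlier ones ends
  -- no occurrence.
  quiet-new : ∀ {e hi} k → hi < k → Elems (_≤ hi) e → All (Quiet e k) T₁
  quiet-new k lt b =
    (λ i (_ , x≡k , _) → too-big lt b (fst⊆ i) (≤-reflexive (sym x≡k))) ∷
    (λ i (_ , x≡k , _) → too-big lt b (fst⊆ i) (≤-reflexive (sym x≡k))) ∷
    (λ i (_ , k<x , _) → too-big lt b (fst⊆ i) (<⇒≤ k<x)) ∷
    (λ i (_ , k<x , _) → too-big lt b (fst⊆ i) (<⇒≤ k<x)) ∷ []

  quiet-within : ∀ {e lo hi β} (G : Good e lo hi β) → ∀ k → lo ≤ k → k ≤ Good.last G → All (Quiet e k) T₁
  quiet-within {e} {lo} G k p q =
    (λ i (x<y , x≡k , _) → no-rise i (≤-reflexive (sym x≡k)) x<y) ∷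
    (λ i (y<x , x≡k , y<k) → no-dip i (≤-reflexive (sym x≡k)) y<k) ∷
    (λ i (x<y , k<x , _) → no-rise i (<⇒≤ k<x) x<y) ∷
    (λ i (y<x , k<x , y<k) → no-dip i (<⇒≤ k<x) y<k) ∷ []
    where
    no-rise : ∀ {x y} → (x ∷ y ∷ []) ⊆ e → k ≤ x → ¬ x < y
    no-rise i kx xy with Good.pairs G i
    ... | inj₁ x<lo     = <⇒≱ x<lo (≤-trans p kx)
    ... | inj₂ (_ , yx) = <⇒≱ xy yx
    no-dip : ∀ {x y} → (x ∷ y ∷ []) ⊆ e → k ≤ x → ¬ y < k
    no-dip i kx yk with Good.pairs G i
    ... | inj₁ x<lo     = <⇒≱ x<lo (≤-trans p kx)
    ... | inj₂ (ly , _) = <⇒≱ yk (≤-trans q ly)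

  good-within : ∀ {e lo hi β} → Good e lo hi β → ∀ k β′ → lo ≤ k → lo + suc β′ ≡ suc k → lo + suc β′ ≤ lo + β → Good (e ++ [ k ]) lo hi (suc β′)
  good-within {e} {lo} {hi} G k β′ p eq le = record
    { last  = k
    ; core  = Core-within (≤-trans k≤last (Good.≤hi G)) (Good.core G) (quiet-within G k p k≤last)
    ; lo+β  = eq
    ; lo≤   = p
    ; ≤hi   = ≤-trans k≤last (Good.≤hi G)
    ; pairs = Pairs-snoc {e = e} (λ i → map-⊎ (λ z → z) (λ (u , v) → ≤-trans k≤last u , v) (Good.pairs G i))
                (λ i → map-⊎ (λ z → z) (λ u → ≤-refl , ≤-trans k≤last u) (Good.elems G i))
    ; elems = Elems-snoc {e = e} (λ i → map-⊎ (λ z → z) (≤-trans k≤last) (Good.elems G i)) (inj₂ ≤-refl)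
    ; wit   = inj₂ (snoc-⊆ k (core-hi∈ (Good.core G)))
    }
    where
    k≤last : k ≤ Good.last G
    k≤last = s≤s⁻¹ (subst₂ _≤_ eq (Good.lo+β G) le)

  -- After `hi` and `last`, an entry above `last` completes 201 if it is below `hi`, and 101 if it
  -- equals `hi`.
  above-blocked : ∀ {e lo hi β} (G : Good e lo hi β) k → Good.last G < k → k ≤ hi → avoidsAll T₁ (e ++ [ k ]) ≡ false
  above-blocked G k p q with Good.wit G
  ... | inj₁ refl = ⊥-elim (<⇒≱ p q)
  ... | inj₂ i with m≤n⇒m<n∨m≡n q
  ...   | inj₁ k<hi = blocked {T₁} 2 0 1 (there ∈₃) i (<-≤-trans p q , k<hi , p)
  ...   | inj₂ refl = blocked {T₁} 1 0 1 (there ∈₁) i (p , refl , p)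

  class : Class T₁
  class = record
    { Good = Good
    ; start = record
      { last = 0
      ; core = Core-start (refl ∷ refl ∷ refl ∷ refl ∷ [])
      ; lo+β = refl ; lo≤ = z≤n ; ≤hi = z≤n
      ; pairs = λ i → ⊥-elim (no-pair i)
      ; elems = λ _ → inj₂ z≤n
      ; wit = inj₁ refl }
    ; avoids = λ G → core-avoids (Good.core G)
    ; bound = λ G → core-bound (Good.core G)
    ; hi∈ = λ G → core-hi∈ (Good.core G)
    ; again = λ G → good-within G 0 0 z≤n refl ≤-refl
    ; new = λ {e} {lo} {hi} t G → record
      { last = suc hi + t
      ; core = Core-new t (Good.core G) (quiet-new (suc hi + t) (m≤m+n (suc hi) t) (core-bound (Good.core G)))
      ; lo+β = +-suc (suc hi) t
      ; lo≤ = m≤m+n (suc hi) t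
      ; ≤hi = ≤-refl
      ; pairs = Pairs-snoc {λ x y → x < suc hi ⊎ (suc hi + t ≤ y × y ≤ x)} {e}
          (λ i → inj₁ (s≤s (core-bound (Good.core G) (fst⊆ i)))) (λ i → inj₁ (s≤s (core-bound (Good.core G) i)))
      ; elems = Elems-snoc {λ x → x < suc hi ⊎ suc hi + t ≤ x} {e} (λ i → inj₁ (s≤s (core-bound (Good.core G) i))) (inj₂ ≤-refl)
      ; wit = inj₁ refl }
    ; within = within
    }
    where
    within : ∀ {e lo hi β} → Good e lo hi β → (g h : ℕ → ℕ) →
      (∀ k → avoidsAll T₁ (e ++ [ k ]) ≡ false → g k ≡ 0) →
      (∀ k β′ → lo ≤ k → k ≤ hi → Good (e ++ [ k ]) lo hi β′ → g k ≡ h β′) →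
      ∑ (suc hi) g ≡ ∑ β (λ b → h (suc b))
    within {e} {lo} {hi} {β} G g h dead live = begin
      ∑ (suc hi) g
        ≡⟨ cong (λ n → ∑ n g) range ⟩
      -- The letters 0, ..., `hi` are the `lo` letters below the block, the β letters from `lo` to
      -- `last`, and the rest above `last`.
      ∑ (lo + (β + rest)) g
        ≡⟨ trans (∑-split lo (β + rest) g) (cong (∑ lo g +_) (∑-split β rest (λ i → g (lo + i)))) ⟩
      ∑ lo g + (∑ β (λ i → g (lo + i)) + ∑ rest (λ i → g (lo + (β + i))))
        ≡⟨ cong₂ _+_ (∑-zero< lo (λ k lt → dead k (below-blocked {T₁} ∈₁ ∈₃ (Good.core G) lt)))
             (cong₂ _+_ (∑-cong< β mid) (∑-zero< rest top)) ⟩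
      ∑ β (λ b → h (suc b)) + 0
        ≡⟨ +-identityʳ _ ⟩
      ∑ β (λ b → h (suc b)) ∎
      where
      open ≡-Reasoning
      rest = hi ∸ Good.last G
      range : suc hi ≡ lo + (β + rest)
      range = sym (trans (sym (+-assoc lo β rest)) (trans (cong (_+ rest) (Good.lo+β G)) (cong suc (m+[n∸m]≡n (Good.≤hi G)))))
      mid : ∀ i → i < β → g (lo + i) ≡ h (suc i)
      mid i lt = live (lo + i) (suc i) (m≤m+n lo i) (≤-trans (s≤s⁻¹ (subst (lo + i <_) (Good.lo+β G) (+-monoʳ-< lo lt))) (Good.≤hi G))
        (good-within G (lo + i) i (m≤m+n lo i) (+-suc lo i) (+-monoʳ-≤ lo lt))
      top : ∀ i → i < rest → g (lo + (β + i)) ≡ 0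
      top i lt = dead _ (above-blocked G _
        (subst (Good.last G <_) (trans (cong (_+ i) (sym (Good.lo+β G))) (+-assoc lo β i)) (s≤s (m≤m+n (Good.last G) i)))
        (s≤s⁻¹ (subst (lo + (β + i) <_) (sym range) (+-monoʳ-< lo (+-monoʳ-< β lt)))))

module Increasing where

  -- l bounds the next entry of the current block from below.
  record Good (e : List ℕ) (lo hi β : ℕ) : Set where
    field
      l     : ℕ
      core  : Core T₂ e lo hi
      l+β   : l + β ≡ suc hi
      lo≤l  : lo ≤ l
      pairs : Pairs (λ x y → x < lo ⊎ y ≤ l) e
      wit   : l ≤ lo ⊎ (l ≤ hi × (hi ∷ l ∷ []) ⊆ e)

  quiet-new : ∀ {e hi} k → hi < k → Elems (_≤ hi) e → All (Quiet e k) T₂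
  quiet-new k lt b =
    (λ i (_ , x≡k , _) → too-big lt b (fst⊆ i) (≤-reflexive (sym x≡k))) ∷
    (λ i (_ , k<x , _) → too-big lt b (fst⊆ i) (<⇒≤ k<x)) ∷
    (λ i (_ , k<x , _) → too-big lt b (fst⊆ i) (<⇒≤ k<x)) ∷
    (λ i (_ , k<x , _) → too-big lt b (fst⊆ i) (<⇒≤ k<x)) ∷ []

  -- In each pattern the first letter is at least the last and the second exceeds it; no such pair
  -- precedes k, because within the block only the leading maximum exceeds the bound `l`.
  quiet-within : ∀ {e lo hi β} (G : Good e lo hi β) → ∀ k → Good.l G ≤ k → All (Quiet e k) T₂
  quiet-within {e} {lo} G k p =
    (λ i (_ , x≡k , k<y) → no-above i (≤-reflexive (sym x≡k)) k<y) ∷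
    (λ i (_ , k<x , k<y) → no-above i (<⇒≤ k<x) k<y) ∷
    (λ i (_ , k<x , k<y) → no-above i (<⇒≤ k<x) k<y) ∷
    (λ i (_ , k<x , k<y) → no-above i (<⇒≤ k<x) k<y) ∷ []
    where
    no-above : ∀ {x y} → (x ∷ y ∷ []) ⊆ e → k ≤ x → ¬ k < y
    no-above i kx ky with Good.pairs G i
    ... | inj₁ x<lo = <⇒≱ x<lo (≤-trans (Good.lo≤l G) (≤-trans p kx))
    ... | inj₂ yl   = <⇒≱ ky (≤-trans yl p)

  good-within : ∀ {e lo hi β} (G : Good e lo hi β) → ∀ k β′ → Good.l G ≤ k → k ≤ hi → k + β′ ≡ suc hi → Good (e ++ [ k ]) lo hi β′
  good-within {e} {lo} {hi} G k β′ p q eq = record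
    { l     = k
    ; core  = Core-within q (Good.core G) (quiet-within G k p)
    ; l+β   = eq
    ; lo≤l  = ≤-trans (Good.lo≤l G) p
    ; pairs = Pairs-snoc {λ x y → x < lo ⊎ y ≤ k} {e} (λ i → map-⊎ (λ z → z) (λ u → ≤-trans u p) (Good.pairs G i)) (λ _ → inj₂ ≤-refl)
    ; wit   = inj₂ (q , snoc-⊆ k (core-hi∈ (Good.core G)))
    }

  -- After `hi` and `l`, a smaller entry completes 210, or 110 if `l` equals `hi`.
  below-l : ∀ {e lo hi β} (G : Good e lo hi β) k → k < Good.l G → avoidsAll T₂ (e ++ [ k ]) ≡ false
  below-l {lo = lo} G k p with k <? lo
  ... | yes k<lo = below-blocked {T₂} ∈₁ ∈₃ (Good.core G) k<lo
  ... | no k≮lo with Good.wit G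
  ...   | inj₁ l≤lo    = ⊥-elim (k≮lo (≤-trans p l≤lo))
  ...   | inj₂ (q , i) with m≤n⇒m<n∨m≡n q
  ...     | inj₁ l<hi = blocked {T₂} 2 1 0 (there ∈₃) i (l<hi , <-trans p l<hi , p)
  ...     | inj₂ l≡hi = blocked {T₂} 1 1 0 (there ∈₁) i (sym l≡hi , subst (k <_) l≡hi p , p)

  class : Class T₂
  class = record
    { Good = Good
    ; start = record
      { l = 0
      ; core = Core-start (refl ∷ refl ∷ refl ∷ refl ∷ [])
      ; l+β = refl ; lo≤l = z≤n
      ; pairs = λ i → ⊥-elim (no-pair i)
      ; wit = inj₁ z≤n }
    ; avoids = λ G → core-avoids (Good.core G)
    ; bound = λ G → core-bound (Good.core G)
    ; hi∈ = λ G → core-hi∈ (Good.core G)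
    ; again = λ G → good-within G 0 1 (≤-reflexive (suc-injective (trans (+-comm 1 (Good.l G)) (Good.l+β G)))) z≤n refl
    ; new = λ {e} {lo} {hi} t G → record
      { l = suc hi
      ; core = Core-new t (Good.core G) (quiet-new (suc hi + t) (m≤m+n (suc hi) t) (core-bound (Good.core G)))
      ; l+β = +-suc (suc hi) t
      ; lo≤l = ≤-refl
      ; pairs = Pairs-snoc {λ x y → x < suc hi ⊎ y ≤ suc hi} {e}
          (λ i → inj₁ (s≤s (core-bound (Good.core G) (fst⊆ i)))) (λ i → inj₁ (s≤s (core-bound (Good.core G) i)))
      ; wit = inj₁ ≤-refl }
    ; within = within
    }
    where
    within : ∀ {e lo hi β} → Good e lo hi β → (g h : ℕ → ℕ) →
      (∀ k → avoidsAll T₂ (e ++ [ k ]) ≡ false → g k ≡ 0) →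
      (∀ k β′ → lo ≤ k → k ≤ hi → Good (e ++ [ k ]) lo hi β′ → g k ≡ h β′) →
      ∑ (suc hi) g ≡ ∑ β (λ b → h (suc b))
    within {e} {lo} {hi} {β} G g h dead live = begin
      ∑ (suc hi) g
        ≡⟨ cong (λ n → ∑ n g) (sym (Good.l+β G)) ⟩
      ∑ (l + β) g
        ≡⟨ ∑-split l β g ⟩
      ∑ l g + ∑ β (λ i → g (l + i))
        ≡⟨ cong₂ _+_ (∑-zero< l (λ k lt → dead k (below-l G k lt))) (∑-cong< β mid) ⟩
      ∑ β (λ i → h (β ∸ i))
        ≡⟨ ∑-reverse β h ⟩
      ∑ β (λ b → h (suc b)) ∎
      where
      open ≡-Reasoning
      l = Good.l G
      mid : ∀ i → i < β → g (l + i) ≡ h (β ∸ i)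
      mid i lt = live (l + i) (β ∸ i) (≤-trans (Good.lo≤l G) (m≤m+n l i)) k≤hi
        (good-within G (l + i) (β ∸ i) (m≤m+n l i) k≤hi (trans (+-assoc l i (β ∸ i)) (trans (cong (l +_) (m+[n∸m]≡n (<⇒≤ lt))) (Good.l+β G))))
        where
        k≤hi : l + i ≤ hi
        k≤hi = s≤s⁻¹ (subst (l + i <_) (Good.l+β G) (+-monoʳ-< l lt))

module Sparse where

  -- l bounds from below the next entry of the current block that differs from hi.
  record Good (e : List ℕ) (lo hi β : ℕ) : Set where
    field
      l     : ℕ
      core  : Core T₃ e lo hi
      l+β   : l + β ≡ suc hi
      lo≤l  : lo ≤ l
      l≤hi  : l ≤ hi
      pairs : Pairs (λ x y → x < lo ⊎ ((x < l ⊎ x ≡ hi) × (y < l ⊎ y ≡ hi))) e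
      elems : Elems (λ x → x < l ⊎ x ≡ hi) e
      wit   : l ≤ lo ⊎ ∃[ s ] l ≡ suc s × (hi ∷ s ∷ []) ⊆ e

  quiet-new : ∀ {e hi} k → hi < k → Elems (_≤ hi) e → All (Quiet e k) T₃
  quiet-new k lt b =
    (λ i (_ , x≡k , _) → too-big lt b (fst⊆ i) (≤-reflexive (sym x≡k))) ∷
    (λ i (_ , k<x , _) → too-big lt b (fst⊆ i) (<⇒≤ k<x)) ∷
    (λ i (_ , k<x , _) → too-big lt b (fst⊆ i) (<⇒≤ k<x)) ∷
    (λ i (_ , k<x , _) → too-big lt b (fst⊆ i) (<⇒≤ k<x)) ∷ []

  -- Each pattern ends in its minimum and begins with two different letters, whereas two entries of
  -- e that are at least k must both be `hi`.
  quiet-within : ∀ {e lo hi β} (G : Good e lo hi β) → ∀ k → Good.l G ≤ k → All (Quiet e k) T₃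
  quiet-within {e} {lo} {hi} G k p =
    (λ i (x<y , x≡k , k<y) → <⇒≢ x<y (same i (≤-reflexive (sym x≡k)) (<⇒≤ k<y))) ∷
    (λ i (y<x , k<x , y≡k) → >⇒≢ y<x (same i (<⇒≤ k<x) (≤-reflexive (sym y≡k)))) ∷
    (λ i (x<y , k<x , k<y) → <⇒≢ x<y (same i (<⇒≤ k<x) (<⇒≤ k<y))) ∷
    (λ i (y<x , k<x , k<y) → >⇒≢ y<x (same i (<⇒≤ k<x) (<⇒≤ k<y))) ∷ []
    where
    is-hi : ∀ {x} → k ≤ x → x < Good.l G ⊎ x ≡ hi → x ≡ hi
    is-hi kx (inj₁ xl) = ⊥-elim (<⇒≱ xl (≤-trans p kx))
    is-hi kx (inj₂ eq) = eq
    same : ∀ {x y} → (x ∷ y ∷ []) ⊆ e → k ≤ x → k ≤ y → x ≡ y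
    same i kx ky with Good.pairs G i
    ... | inj₁ x<lo    = ⊥-elim (<⇒≱ x<lo (≤-trans (Good.lo≤l G) (≤-trans p kx)))
    ... | inj₂ (u , v) = trans (is-hi kx u) (sym (is-hi ky v))

  good-hi : ∀ {e lo hi β} → Good e lo hi β → Good (e ++ [ hi ]) lo hi β
  good-hi {e} {lo} {hi} G = record
    { l     = Good.l G
    ; core  = Core-within ≤-refl (Good.core G) (quiet-within G hi (Good.l≤hi G))
    ; l+β   = Good.l+β G
    ; lo≤l  = Good.lo≤l G
    ; l≤hi  = Good.l≤hi G
    ; pairs = Pairs-snoc {λ x y → x < lo ⊎ ((x < Good.l G ⊎ x ≡ hi) × (y < Good.l G ⊎ y ≡ hi))} {e}
                (Good.pairs G) (λ i → inj₂ (Good.elems G i , inj₂ refl))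
    ; elems = Elems-snoc {λ x → x < Good.l G ⊎ x ≡ hi} {e} (Good.elems G) (inj₂ refl)
    ; wit   = map-⊎ (λ z → z) (λ (s , eq , i) → s , eq , ⊆-trans i (⊆-snoc e)) (Good.wit G)
    }

  good-small : ∀ {e lo hi β} (G : Good e lo hi β) → ∀ k β′ → Good.l G ≤ k → k < hi → suc k + β′ ≡ suc hi → Good (e ++ [ k ]) lo hi β′
  good-small {e} {lo} {hi} G k β′ p q eq = record
    { l     = suc k
    ; core  = Core-within (<⇒≤ q) (Good.core G) (quiet-within G k p)
    ; l+β   = eq
    ; lo≤l  = m≤n⇒m≤1+n (≤-trans (Good.lo≤l G) p)
    ; l≤hi  = q
    ; pairs = Pairs-snoc {λ x y → x < lo ⊎ ((x < suc k ⊎ x ≡ hi) × (y < suc k ⊎ y ≡ hi))} {e}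
                (λ i → map-⊎ (λ z → z) (λ (u , v) → widen u , widen v) (Good.pairs G i)) (λ i → inj₂ (widen (Good.elems G i) , inj₁ ≤-refl))
    ; elems = Elems-snoc {λ x → x < suc k ⊎ x ≡ hi} {e} (λ i → widen (Good.elems G i)) (inj₁ ≤-refl)
    ; wit   = inj₂ (k , refl , snoc-⊆ k (core-hi∈ (Good.core G)))
    }
    where
    widen : ∀ {x} → x < Good.l G ⊎ x ≡ hi → x < suc k ⊎ x ≡ hi
    widen = map-⊎ (λ u → m≤n⇒m≤1+n (≤-trans u p)) (λ z → z)

  -- Here l = s + 1 for an entry s that follows `hi`: an entry below s completes 210, and a repeated
  -- s completes 100.
  below-l : ∀ {e lo hi β} (G : Good e lo hi β) k → k < Good.l G → avoidsAll T₃ (e ++ [ k ]) ≡ false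
  below-l {lo = lo} {hi} G k p with k <? lo
  ... | yes k<lo = below-blocked {T₃} ∈₁ ∈₃ (Good.core G) k<lo
  ... | no k≮lo with Good.wit G
  ...   | inj₁ l≤lo         = ⊥-elim (k≮lo (≤-trans p l≤lo))
  ...   | inj₂ (s , eq , i) = go (m≤n⇒m<n∨m≡n (s≤s⁻¹ (subst (k <_) eq p)))
    where
    s<hi : s < hi
    s<hi = subst (_≤ hi) eq (Good.l≤hi G)
    go : k < s ⊎ k ≡ s → _
    go (inj₁ k<s)  = blocked {T₃} 2 1 0 (there ∈₃) i (s<hi , <-trans k<s s<hi , k<s)
    go (inj₂ refl) = blocked {T₃} 1 0 0 (there ∈₁) i (s<hi , s<hi , refl)

  class : Class T₃
  class = record
    { Good = Good
    ; start = record
      { l = 0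
      ; core = Core-start (refl ∷ refl ∷ refl ∷ refl ∷ [])
      ; l+β = refl ; lo≤l = z≤n ; l≤hi = z≤n
      ; pairs = λ i → ⊥-elim (no-pair i)
      ; elems = λ { (refl ∷ []) → inj₂ refl ; (_ ∷ʳ ()) }
      ; wit = inj₁ z≤n }
    ; avoids = λ G → core-avoids (Good.core G)
    ; bound = λ G → core-bound (Good.core G)
    ; hi∈ = λ G → core-hi∈ (Good.core G)
    ; again = good-hi
    ; new = λ {e} {lo} {hi} t G → record
      { l = suc hi
      ; core = Core-new t (Good.core G) (quiet-new (suc hi + t) (m≤m+n (suc hi) t) (core-bound (Good.core G)))
      ; l+β = +-suc (suc hi) t
      ; lo≤l = ≤-refl
      ; l≤hi = m≤m+n (suc hi) t
      ; pairs = Pairs-snoc {λ x y → x < suc hi ⊎ ((x < suc hi ⊎ x ≡ suc hi + t) × (y < suc hi ⊎ y ≡ suc hi + t))} {e}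
          (λ i → inj₁ (s≤s (core-bound (Good.core G) (fst⊆ i)))) (λ i → inj₁ (s≤s (core-bound (Good.core G) i)))
      ; elems = Elems-snoc {λ x → x < suc hi ⊎ x ≡ suc hi + t} {e} (λ i → inj₁ (s≤s (core-bound (Good.core G) i))) (inj₂ refl)
      ; wit = inj₁ ≤-refl }
    ; within = within
    }
    where
    within : ∀ {e lo hi β} → Good e lo hi β → (g h : ℕ → ℕ) →
      (∀ k → avoidsAll T₃ (e ++ [ k ]) ≡ false → g k ≡ 0) →
      (∀ k β′ → lo ≤ k → k ≤ hi → Good (e ++ [ k ]) lo hi β′ → g k ≡ h β′) →
      ∑ (suc hi) g ≡ ∑ β (λ b → h (suc b))
    -- The count β includes `hi` itself, so it cannot be 0.
    within {e} {lo} {hi} {zero} G g h dead live = ⊥-elim (<⇒≱ (≤-reflexive (trans (sym (Good.l+β G)) (+-identityʳ _))) (Good.l≤hi G))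
    within {e} {lo} {hi} {suc β} G g h dead live = begin
      ∑ (suc hi) g
        ≡⟨ ∑-last hi g ⟩
      ∑ hi g + g hi
        -- Repeating `hi` leaves the number of continuations unchanged, so this letter takes the
        -- largest label; the others take the smaller labels in descending order.
        ≡⟨ cong₂ _+_ (cong (λ n → ∑ n g) (sym l+β)) (live hi (suc β) (≤-trans (Good.lo≤l G) (Good.l≤hi G)) ≤-refl (good-hi G)) ⟩
      ∑ (l + β) g + h (suc β)
        ≡⟨ cong (_+ h (suc β)) (∑-split l β g) ⟩
      ∑ l g + ∑ β (λ i → g (l + i)) + h (suc β)
        ≡⟨ cong (_+ h (suc β)) (cong₂ _+_ (∑-zero< l (λ k lt → dead k (below-l G k lt))) (∑-cong< β mid)) ⟩
      ∑ β (λ i → h (β ∸ i)) + h (suc β)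
        ≡⟨ cong (_+ h (suc β)) (∑-reverse β h) ⟩
      ∑ β (λ b → h (suc b)) + h (suc β)
        ≡⟨ sym (∑-last β (λ b → h (suc b))) ⟩
      ∑ (suc β) (λ b → h (suc b)) ∎
      where
      open ≡-Reasoning
      l = Good.l G
      l+β : l + β ≡ hi
      l+β = suc-injective (trans (sym (+-suc l β)) (Good.l+β G))
      mid : ∀ i → i < β → g (l + i) ≡ h (β ∸ i)
      mid i lt = live (l + i) (β ∸ i) (≤-trans (Good.lo≤l G) (m≤m+n l i)) (<⇒≤ k<hi)
        (good-small G (l + i) (β ∸ i) (m≤m+n l i) k<hi
          (cong suc (trans (+-assoc l i (β ∸ i)) (trans (cong (l +_) (m+[n∸m]≡n (<⇒≤ lt))) l+β))))
        where
        k<hi : l + i < hi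
        k<hi = subst (l + i <_) l+β (+-monoʳ-< l lt)

-- Effect of an appended entry on the statistics.

ι : Bool → ℕ
ι b = if b then 1 else 0

bump≡+ι : ∀ b n → bump b n ≡ n + ι b
bump≡+ι false n = sym (+-identityʳ n)
bump≡+ι true  n = +-comm 1 n

+-bumpʳ : ∀ b m n → m + bump b n ≡ bump b (m + n)
+-bumpʳ false m n = refl
+-bumpʳ true  m n = +-suc m n

zeros-snoc : ∀ e k → zeros (e ++ [ k ]) ≡ bump (k ≡ᵇ 0) (zeros e)
zeros-snoc []      k = trans (+-identityʳ _) (sym (bump≡+ι (k ≡ᵇ 0) 0))
zeros-snoc (x ∷ e) k = trans (cong (ι (x ≡ᵇ 0) +_) (zeros-snoc e k)) (+-bumpʳ (k ≡ᵇ 0) _ _)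

highFrom-snoc : ∀ j e k → highFrom j (e ++ [ k ]) ≡ bump (k ≡ᵇ j + length e) (highFrom j e)
highFrom-snoc j []      k = trans (+-identityʳ _) (trans (cong (λ z → ι (k ≡ᵇ z)) (sym (+-identityʳ j))) (sym (bump≡+ι (k ≡ᵇ j + 0) 0)))
highFrom-snoc j (x ∷ e) k = trans (cong (ι (x ≡ᵇ j) +_) (highFrom-snoc (suc j) e k))
  (trans (+-bumpʳ (k ≡ᵇ suc j + length e) (ι (x ≡ᵇ j)) _) (cong (λ z → bump (k ≡ᵇ z) (ι (x ≡ᵇ j) + highFrom (suc j) e)) (sym (+-suc j (length e)))))

maxEntry-snoc : ∀ e k → maxEntry (e ++ [ k ]) ≡ maxEntry e ⊔ k
maxEntry-snoc []      k = ⊔-identityʳ k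
maxEntry-snoc (x ∷ e) k = trans (cong (x ⊔_) (maxEntry-snoc e k)) (sym (⊔-assoc x _ k))

ltrFrom-snoc : ∀ pre e k → ltrFrom pre (e ++ [ k ]) ≡ bump (all (λ y → y <ᵇ k) (pre ++ e)) (ltrFrom pre e)
ltrFrom-snoc pre []      k = trans (+-identityʳ _) (trans (cong (λ z → ι (all (λ y → y <ᵇ k) z)) (sym (++-identityʳ pre))) (sym (bump≡+ι (all (λ y → y <ᵇ k) (pre ++ [])) 0)))
ltrFrom-snoc pre (x ∷ e) k = trans (cong (ι (all (λ y → y <ᵇ x) pre) +_) (ltrFrom-snoc (pre ++ [ x ]) e k))
  (trans (+-bumpʳ (all (λ y → y <ᵇ k) ((pre ++ [ x ]) ++ e)) (ι (all (λ y → y <ᵇ x) pre)) _)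
    (cong (λ z → bump (all (λ y → y <ᵇ k) z) (ι (all (λ y → y <ᵇ x) pre) + ltrFrom (pre ++ [ x ]) e)) (++-assoc pre [ x ] e)))

all<-true : ∀ e k → Elems (_< k) e → all (λ y → y <ᵇ k) e ≡ true
all<-true []      k p = refl
all<-true (x ∷ e) k p rewrite <⇒<ᵇ≡ (p (refl ∷ minimum e)) = all<-true e k (λ i → p (x ∷ʳ i))

all<-false : ∀ e k {x} → [ x ] ⊆ e → k ≤ x → all (λ y → y <ᵇ k) e ≡ false
all<-false (y ∷ e) k (_ ∷ʳ i) le rewrite all<-false e k i le = ∧-zeroʳ (y <ᵇ k)
all<-false (y ∷ e) k (refl ∷ i) le rewrite ≥⇒<ᵇ≡ le = refl

-- Counting by extension.

sumBy : ∀ {A : Set} → (A → ℕ) → List A → ℕ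
sumBy f []       = 0
sumBy f (x ∷ xs) = f x + sumBy f xs

sumBy-++ : ∀ {A : Set} (f : A → ℕ) xs ys → sumBy f (xs ++ ys) ≡ sumBy f xs + sumBy f ys
sumBy-++ f []       ys = refl
sumBy-++ f (x ∷ xs) ys = trans (cong (f x +_) (sumBy-++ f xs ys)) (sym (+-assoc (f x) _ _))

sumBy-concatMap : ∀ {A B : Set} (f : B → ℕ) (g : A → List B) xs → sumBy f (concatMap g xs) ≡ sumBy (λ x → sumBy f (g x)) xs
sumBy-concatMap f g []       = refl
sumBy-concatMap f g (x ∷ xs) = trans (sumBy-++ f (g x) (concatMap g xs)) (cong (sumBy f (g x) +_) (sumBy-concatMap f g xs))

sumBy-applyUpTo : ∀ {A : Set} (f : A → ℕ) (g : ℕ → A) h n → sumBy f (map g (applyUpTo h n)) ≡ ∑ n (λ k → f (g (h k)))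
sumBy-applyUpTo f g h zero    = refl
sumBy-applyUpTo f g h (suc n) = cong (f (g (h 0)) +_) (sumBy-applyUpTo f g (λ k → h (suc k)) n)

sumBy-cong : ∀ {A : Set} {f g : A → ℕ} → (∀ x → f x ≡ g x) → ∀ xs → sumBy f xs ≡ sumBy g xs
sumBy-cong p []       = refl
sumBy-cong p (x ∷ xs) = cong₂ _+_ (p x) (sumBy-cong p xs)

length-filterᵇ : ∀ {A : Set} (p : A → Bool) xs → length (filterᵇ p xs) ≡ sumBy (λ x → ι (p x)) xs
length-filterᵇ p []       = refl
length-filterᵇ p (x ∷ xs) with p x
... | true  = cong suc (length-filterᵇ p xs)
... | false = length-filterᵇ p xs

ext : (List ℕ → Bool) → ℕ → ℕ → List ℕ → ℕ
ext p zero    n e = ι (p e)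
ext p (suc r) n e = ∑ (suc n) (λ k → ext p r (suc n) (e ++ [ k ]))

countInv-ext : ∀ p r n → countInv (r + n) p ≡ sumBy (ext p r n) (invSeqs n)
countInv-ext p zero    n = length-filterᵇ p (invSeqs n)
countInv-ext p (suc r) n = begin
  countInv (suc r + n) p
    ≡⟨ cong (λ m → countInv m p) (sym (+-suc r n)) ⟩
  countInv (r + suc n) p
    ≡⟨ countInv-ext p r (suc n) ⟩
  sumBy (ext p r (suc n)) (invSeqs (suc n))
    ≡⟨ sumBy-concatMap (ext p r (suc n)) (λ e → map (λ k → e ++ [ k ]) (upTo (suc n))) (invSeqs n) ⟩
  sumBy (λ e → sumBy (ext p r (suc n)) (map (λ k → e ++ [ k ]) (upTo (suc n)))) (invSeqs n)
    ≡⟨ sumBy-cong (λ e → sumBy-applyUpTo (ext p r (suc n)) (λ k → e ++ [ k ]) (λ k → k) (suc n)) (invSeqs n) ⟩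
  sumBy (ext p (suc r) n) (invSeqs n) ∎
  where open ≡-Reasoning

-- Here t is the rise of the new maximum above the least possible one; it leaves height i - t, and t
-- = i is the high choice.
∑-fall : ∀ {h h₀} c i (f : ℕ → ℕ) →
  (∀ t i′ → t + suc i′ ≡ i → f t ≡ h (suc i′) (suc (c + t))) → f i ≡ h₀ (suc (c + i)) →
  ∑ (suc i) f ≡ fall h h₀ c i
∑-fall {h₀ = h₀} c zero    f p q = trans (+-identityʳ _) (trans q (cong (λ z → h₀ (suc z)) (+-identityʳ c)))
∑-fall {h} {h₀} c (suc i) f p q = cong₂ _+_ (trans (p 0 i refl) (cong (λ z → h (suc i) (suc z)) (+-identityʳ c)))
  (∑-fall (suc c) i (λ t → f (suc t))
    (λ t i′ eq → trans (p (suc t) i′ (cong suc eq)) (cong (λ z → h (suc i′) (suc z)) (+-suc c t)))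
    (trans q (cong (λ z → h₀ (suc z)) (+-suc c i))))

-- As in `Tree`, `i` is the bounce less one and `j` the number of zeros less one.
record Stats (e : List ℕ) (n hi i j b d : ℕ) : Set where
  field
    length≡ : length e ≡ n
    n≡      : n ≡ suc (hi + i)
    max≡    : maxEntry e ≡ hi
    zeros≡  : zeros e ≡ suc j
    ltr≡    : ltrMax e ≡ b
    high≡   : high e ≡ d

module Joint (T : List (List ℕ)) (C : Class T) (q₁ q₂ q₃ q₄ : ℕ) where
  open Class C

  target : List ℕ → Bool
  target e = avoidsAll T e ∧ (zeros e ≡ᵇ q₁) ∧ (ltrMax e ≡ᵇ q₂) ∧ (bounce e ≡ᵇ q₃) ∧ (high e ≡ᵇ q₄)

  F : ℕ → ℕ → ℕ → ℕ → ℕ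
  F j i b d = ι ((suc j ≡ᵇ q₁) ∧ (b ≡ᵇ q₂) ∧ (suc i ≡ᵇ q₃) ∧ (d ≡ᵇ q₄))

  open Tree F

  dead : ∀ r n e → avoidsAll T e ≡ false → ext target r n e ≡ 0
  dead zero    n e p rewrite p = refl
  dead (suc r) n e p = ∑-zero< (suc n) (λ k _ → dead r (suc n) (e ++ [ k ]) (avoidsAll-anti T e (e ++ [ k ]) (⊆-snoc e) p))

  finish : ∀ {e n lo hi β i j b d} → Good e lo hi β → Stats e n hi i j b d → ι (target e) ≡ F j i b d
  finish {e} {hi = hi} {i = i} G s
    rewrite avoidsAll⁺ T e (avoids G) | Stats.zeros≡ s | Stats.ltr≡ s | Stats.high≡ s
          | Stats.length≡ s | Stats.max≡ s | Stats.n≡ s | +-∸-assoc 1 (m≤m+n hi i) | m+n∸m≡n hi i = refl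

  stats-within : ∀ {e n lo hi β i j b d} k {j′} → Good e lo hi β → Stats e n hi i j b d → k ≤ hi →
    bump (k ≡ᵇ 0) (suc j) ≡ suc j′ → Stats (e ++ [ k ]) (suc n) hi (suc i) j′ b d
  stats-within {e} {n} {hi = hi} {i = i} {b = b} {d} k G s le eq = record
    { length≡ = trans (length-++ e) (trans (+-comm (length e) 1) (cong suc (Stats.length≡ s)))
    ; n≡      = cong suc (trans (Stats.n≡ s) (sym (+-suc hi i)))
    ; max≡    = trans (maxEntry-snoc e k) (trans (cong (_⊔ k) (Stats.max≡ s)) (m≥n⇒m⊔n≡m le))
    ; zeros≡  = trans (zeros-snoc e k) (trans (cong (bump (k ≡ᵇ 0)) (Stats.zeros≡ s)) eq)
    ; ltr≡    = trans (ltrFrom-snoc [] e k) (trans (cong (λ z → bump z (ltrMax e)) (all<-false e k (hi∈ G) le)) (Stats.ltr≡ s))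
    ; high≡   = trans (highFrom-snoc 0 e k) (trans (cong (λ z → bump z (high e)) (≢⇒≡ᵇ≡ k≢n)) (Stats.high≡ s))
    }
    where
    k≢n : k ≢ length e
    k≢n refl = <⇒≱ (s≤s (m≤m+n hi i)) (subst (_≤ hi) (trans (Stats.length≡ s) (Stats.n≡ s)) le)

  stats-new : ∀ {e n lo hi β i j b d} t i′ d′ → Good e lo hi β → Stats e n hi i j b d → t + i′ ≡ i →
    bump (suc hi + t ≡ᵇ n) d ≡ d′ → Stats (e ++ [ suc hi + t ]) (suc n) (suc hi + t) i′ j (suc b) d′
  stats-new {e} {n} {hi = hi} {i = i} {d = d} t i′ d′ G s eq hd = record
    { length≡ = trans (length-++ e) (trans (+-comm (length e) 1) (cong suc (Stats.length≡ s)))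
    ; n≡      = cong suc (trans (Stats.n≡ s) (cong suc (trans (cong (hi +_) (sym eq)) (sym (+-assoc hi t i′)))))
    ; max≡    = trans (maxEntry-snoc e k) (trans (cong (_⊔ k) (Stats.max≡ s)) (m≤n⇒m⊔n≡n (m≤n⇒m≤1+n (m≤m+n hi t))))
    ; zeros≡  = trans (zeros-snoc e k) (Stats.zeros≡ s)
    ; ltr≡    = trans (ltrFrom-snoc [] e k) (trans (cong (λ z → bump z (ltrMax e)) (all<-true e k (λ x → s≤s (≤-trans (bound G x) (m≤m+n hi t))))) (cong suc (Stats.ltr≡ s)))
    ; high≡   = trans (highFrom-snoc 0 e k) (trans (cong₂ (λ z w → bump (k ≡ᵇ z) w) (Stats.length≡ s) (Stats.high≡ s)) hd)
    }
    where k = suc hi + t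

  split : ∀ {e n hi i j b d} → Stats e n hi i j b d → ∀ g → ∑ (suc n) g ≡ ∑ (suc hi) g + ∑ (suc i) (λ t → g (suc hi + t))
  split {hi = hi} {i} s g = trans (cong (λ z → ∑ z g) (cong suc (trans (Stats.n≡ s) (sym (+-suc hi i))))) (∑-split (suc hi) (suc i) g)

  below-top : ∀ {n hi i t i′} → n ≡ suc (hi + i) → t + suc i′ ≡ i → (suc hi + t ≡ᵇ n) ≡ false
  below-top {hi = hi} {t = t} {i′} refl refl = ≢⇒≡ᵇ≡ (<⇒≢ (s≤s (+-monoʳ-< hi (subst (t <_) (sym (+-suc t i′)) (s≤s (m≤m+n t i′))))))

  at-top : ∀ {n hi i} → n ≡ suc (hi + i) → (suc hi + i ≡ᵇ n) ≡ true
  at-top {hi = hi} {i} refl = ≡ᵇ-refl (suc hi + i)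

  -- The positive lower end `suc m` keeps zeros out of the block, so j stays fixed; the block of
  -- zeros is treated by `ext-M`.
  ext-N : ∀ r {e n m hi β i j b d} → Good e (suc m) hi β → Stats e n hi i j b d → ext target r n e ≡ N j r i β b d
  ext-new : ∀ r {e n lo hi β i j b d} → Good e lo hi β → Stats e n hi i j b d →
    ∑ (suc i) (λ t → ext target r (suc n) (e ++ [ suc hi + t ])) ≡
    fall (λ i D → N j r i D (suc b) d) (λ D → N j r 0 D (suc b) (suc d)) 0 i

  ext-N zero    G s = finish G s
  ext-N (suc r) {e} {n} {m} {hi} {β} {i} {j} {b} {d} G s = trans (split s g) (cong₂ _+_
    (within G g (λ β′ → N j r (suc i) β′ b d) (λ k p → dead r (suc n) (e ++ [ k ]) p) live)
    (ext-new r G s))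
    where
    g : ℕ → ℕ
    g k = ext target r (suc n) (e ++ [ k ])
    live : ∀ k β′ → suc m ≤ k → k ≤ hi → Good (e ++ [ k ]) (suc m) hi β′ → g k ≡ N j r (suc i) β′ b d
    live (suc k) β′ (s≤s _) le G′ = ext-N r G′ (stats-within (suc k) G s le refl)

  ext-new r {e} {n} {lo} {hi} {β} {i} {j} {b} {d} G s = ∑-fall 0 i (λ t → ext target r (suc n) (e ++ [ suc hi + t ]))
    (λ t i′ eq → ext-N r (new t G) (stats-new t (suc i′) d G s eq (cong (λ z → bump z d) (below-top (Stats.n≡ s) eq))))
    (ext-N r (new i G) (stats-new i 0 (suc d) G s (+-identityʳ i) (cong (λ z → bump z d) (at-top {n} {hi} {i} (Stats.n≡ s)))))

  ext-M : ∀ r {e n i} → Good e 0 0 1 → Stats e n 0 i i 1 1 → ext target r n e ≡ M r i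
  ext-M zero    G s = finish G s
  ext-M (suc r) {e} {n} {i} G s = trans (split s (λ k → ext target r (suc n) (e ++ [ k ]))) (cong₂ _+_
    (trans (+-identityʳ _) (ext-M r (again G) (stats-within 0 G s z≤n refl)))
    (ext-new r G s))

  jointCount-M : ∀ r → jointCount (suc r) T zeros ltrMax bounce high q₁ q₂ q₃ q₄ ≡ M r 0
  jointCount-M r = trans (cong (λ z → countInv z target) (sym (+-identityʳ (suc r))))
    (trans (countInv-ext target (suc r) 0)
    (trans (trans (+-identityʳ _) (+-identityʳ _))
      (ext-M r start record { length≡ = refl ; n≡ = refl ; max≡ = refl ; zeros≡ = refl ; ltr≡ = refl ; high≡ = refl })))

-- Enumerations without repetition.

length-filterᵇ-≡ : ∀ {A : Set} (p : A → Bool) {xs ys} → Unique xs → Unique ys →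
  (∀ {x} → x ∈ xs → p x ≡ true → x ∈ ys) → (∀ {x} → x ∈ ys → p x ≡ true → x ∈ xs) →
  length (filterᵇ p xs) ≡ length (filterᵇ p ys)
length-filterᵇ-≡ p {xs} {ys} ux uy f g = ↭-length (∼bag⇒↭ (unique∧set⇒bag
  (Unique.filter⁺ (T? ∘ p) ux) (Unique.filter⁺ (T? ∘ p) uy)
  (λ {x} → mk⇔ (half f) (half g))))
  where
  half : ∀ {us vs x} → (∀ {x} → x ∈ us → p x ≡ true → x ∈ vs) → x ∈ filterᵇ p us → x ∈ filterᵇ p vs
  half h i with ∈-filter⁻ (T? ∘ p) i
  ... | j , px = ∈-filter⁺ (T? ∘ p) (h j (Equivalence.to T-≡ px)) px

Unique-concatMap : ∀ {A B : Set} (f : A → List B) {xs} → Unique xs → (∀ {x} → x ∈ xs → Unique (f x)) →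
  (∀ {x x′ y} → x ∈ xs → x′ ∈ xs → y ∈ f x → y ∈ f x′ → x ≡ x′) → Unique (concatMap f xs)
Unique-concatMap f []       p q = []
Unique-concatMap f (x∉ ∷ u) p q = Unique.++⁺ (p (here refl))
  (Unique-concatMap f u (λ i → p (there i)) (λ i j → q (there i) (there j)))
  (λ (i , j) → let (x′ , k , l) = find (∈-concatMap⁻ f j) in All.lookup x∉ k (q (here refl) (there k) i l))

Unique-map : ∀ {A B : Set} (f : A → B) {xs} → Unique xs → (∀ {x x′} → x ∈ xs → x′ ∈ xs → f x ≡ f x′ → x ≡ x′) → Unique (map f xs)
Unique-map f []       q = []
Unique-map f (x∉ ∷ u) q = All.tabulate (λ i eq → let (x′ , k , eq′) = ∈-map⁻ f i in All.lookup x∉ k (q (here refl) (there k) (trans eq eq′)))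
  ∷ Unique-map f u (λ i j → q (there i) (there j))

-- The list is read as standing from position m on, counted from 0, so `Bounded 0` characterizes
-- inversion sequences.
Bounded : ℕ → List ℕ → Set
Bounded m []       = ⊤
Bounded m (x ∷ xs) = x ≤ m × Bounded (suc m) xs

Bounded-++⁺ : ∀ m us {vs} → Bounded m us → Bounded (m + length us) vs → Bounded m (us ++ vs)
Bounded-++⁺ m []       p       q = subst (λ z → Bounded z _) (+-identityʳ m) q
Bounded-++⁺ m (u ∷ us) {vs} (p , r) q = p , Bounded-++⁺ (suc m) us r (subst (λ z → Bounded z vs) (+-suc m (length us)) q)

Bounded-++⁻ : ∀ m us {vs} → Bounded m (us ++ vs) → Bounded m us × Bounded (m + length us) vs
Bounded-++⁻ m []       p = tt , subst (λ z → Bounded z _) (sym (+-identityʳ m)) p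
Bounded-++⁻ m (u ∷ us) {vs} (p , r) with Bounded-++⁻ (suc m) us r
... | q , s = (p , q) , subst (λ z → Bounded z vs) (sym (+-suc m (length us))) s

Bounded-const : ∀ m vs → Elems (_≤ m) vs → Bounded m vs
Bounded-const m []       p = tt
Bounded-const m (v ∷ vs) p = p (refl ∷ minimum vs) , Bounded-const (suc m) vs (λ i → m≤n⇒m≤1+n (p (v ∷ʳ i)))

∈-invSeqs⁻ : ∀ n {e} → e ∈ invSeqs n → length e ≡ n × Bounded 0 e
∈-invSeqs⁻ zero    (here refl) = refl , tt
∈-invSeqs⁻ (suc n) i with find (∈-concatMap⁻ (λ e → map (λ k → e ++ [ k ]) (upTo (suc n))) i)
... | e , j , k with ∈-map⁻ (λ k → e ++ [ k ]) k | ∈-invSeqs⁻ n j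
...   | x , l , refl | refl , b = trans (length-++ e) (+-comm (length e) 1) , Bounded-++⁺ 0 e b (s≤s⁻¹ (∈-upTo⁻ l) , tt)

∈-invSeqs⁺ : ∀ n {e} → length e ≡ n → Bounded 0 e → e ∈ invSeqs n
∈-invSeqs⁺ zero    {[]} eq b = here refl
∈-invSeqs⁺ (suc n) {e}  eq b with initLast e
... | e′ ∷ʳ′ x = ∈-concatMap⁺ (λ e → map (λ k → e ++ [ k ]) (upTo (suc n)))
  (lose (∈-invSeqs⁺ n len (proj₁ b′)) (∈-map⁺ (λ k → e′ ++ [ k ]) (∈-upTo⁺ (s≤s (subst (x ≤_) len (proj₁ (proj₂ b′)))))))
  where
  len : length e′ ≡ n
  len = suc-injective (trans (+-comm 1 (length e′)) (trans (sym (length-++ e′)) eq))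
  b′ = Bounded-++⁻ 0 e′ b

Unique-invSeqs : ∀ n → Unique (invSeqs n)
Unique-invSeqs zero    = [] ∷ []
Unique-invSeqs (suc n) = Unique-concatMap _ (Unique-invSeqs n)
  (λ {e} _ → Unique.map⁺ (λ eq → proj₂ (∷ʳ-injective e e eq)) (Unique.upTo⁺ (suc n)))
  (λ {e} {e′} _ _ i j → let (_ , _ , p) = ∈-map⁻ (λ k → e ++ [ k ]) i ; (_ , _ , q) = ∈-map⁻ (λ k → e′ ++ [ k ]) j
                        in proj₁ (∷ʳ-injective e e′ (trans (sym p) q)))

-- The final weakly decreasing run.

Decr : List ℕ → Set
Decr = Pairs (λ x y → y ≤ x)

-- The length of that run. The head joins it only if the run already covers the whole tail, which is
-- the first test.
decSuf : List ℕ → ℕ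
decSuf []       = 0
decSuf (x ∷ xs) = if (decSuf xs ≡ᵇ length xs) ∧ all (λ y → y <ᵇ suc x) xs then suc (length xs) else decSuf xs

decSuf≤length : ∀ e → decSuf e ≤ length e
decSuf≤length []       = z≤n
decSuf≤length (x ∷ xs) with (decSuf xs ≡ᵇ length xs) ∧ all (λ y → y <ᵇ suc x) xs
... | true  = ≤-refl
... | false = m≤n⇒m≤1+n (decSuf≤length xs)

decSuf-∷ : ∀ x xs → decSuf xs ≤ decSuf (x ∷ xs)
decSuf-∷ x xs with (decSuf xs ≡ᵇ length xs) ∧ all (λ y → y <ᵇ suc x) xs
... | true  = m≤n⇒m≤1+n (decSuf≤length xs)
... | false = ≤-refl

decSuf-Decr : ∀ vs → Decr vs → decSuf vs ≡ length vs
decSuf-Decr []       d = refl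
decSuf-Decr (v ∷ vs) d
  rewrite decSuf-Decr vs (λ i → d (v ∷ʳ i)) | ≡ᵇ-refl (length vs) | all<-true vs (suc v) (λ i → s≤s (d (refl ∷ i))) = refl

Decr⇒≤decSuf : ∀ us vs → Decr vs → length vs ≤ decSuf (us ++ vs)
Decr⇒≤decSuf []       vs d = ≤-reflexive (sym (decSuf-Decr vs d))
Decr⇒≤decSuf (u ∷ us) vs d = ≤-trans (Decr⇒≤decSuf us vs d) (decSuf-∷ u (us ++ vs))

all<-true⁻ : ∀ e k → all (λ y → y <ᵇ k) e ≡ true → Elems (_< k) e
all<-true⁻ (x ∷ e) k p (_ ∷ʳ i)   = all<-true⁻ e k (proj₂ (∧-true {x <ᵇ k} p)) i
all<-true⁻ (x ∷ e) k p (refl ∷ i) = <ᵇ≡⇒< (proj₁ (∧-true {x <ᵇ k} p))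

≤decSuf⇒Decr : ∀ us vs → length vs ≤ decSuf (us ++ vs) → Decr vs
≤decSuf⇒Decr []       []       le ()
≤decSuf⇒Decr []       (v ∷ vs) le i with (decSuf vs ≡ᵇ length vs) ∧ all (λ y → y <ᵇ suc v) vs in eq
≤decSuf⇒Decr []       (v ∷ vs) le i | false = ⊥-elim (<⇒≱ le (decSuf≤length vs))
≤decSuf⇒Decr []       (v ∷ vs) le (refl ∷ i) | true = s≤s⁻¹ (all<-true⁻ vs (suc v) (proj₂ (∧-true {decSuf vs ≡ᵇ length vs} eq)) i)
≤decSuf⇒Decr []       (v ∷ vs) le (_ ∷ʳ i)   | true = ≤decSuf⇒Decr [] vs (≤-reflexive (sym (≡ᵇ≡⇒≡ (proj₁ (∧-true {decSuf vs ≡ᵇ length vs} eq))))) i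
≤decSuf⇒Decr (u ∷ us) vs       le with (decSuf (us ++ vs) ≡ᵇ length (us ++ vs)) ∧ all (λ y → y <ᵇ suc u) (us ++ vs) in eq
... | false = ≤decSuf⇒Decr us vs le
... | true  = ≤decSuf⇒Decr us vs (subst (length vs ≤_)
  (sym (≡ᵇ≡⇒≡ (proj₁ (∧-true {decSuf (us ++ vs) ≡ᵇ length (us ++ vs)} eq))))
  (subst (length vs ≤_) (sym (length-++ us)) (m≤n+m (length vs) (length us))))

mid-⊆⁺ : ∀ (us : List ℕ) M vs → us ++ vs ⊆ us ++ M ∷ vs
mid-⊆⁺ us M vs = ++⁺ ⊆-refl (M ∷ʳ ⊆-refl)

mid∈ : ∀ (us : List ℕ) M vs → [ M ] ⊆ us ++ M ∷ vs
mid∈ us M vs = ++⁺ˡ us (refl ∷ minimum vs)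

mid-⊆⁻ : ∀ {s : List ℕ} us M vs → s ⊆ us ++ M ∷ vs →
  s ⊆ us ++ vs ⊎ ∃[ s₁ ] ∃[ s₂ ] s ≡ s₁ ++ M ∷ s₂ × s₁ ⊆ us × s₂ ⊆ vs
mid-⊆⁻ []       M vs (_ ∷ʳ i)   = inj₁ i
mid-⊆⁻ []       M vs (refl ∷ i) = inj₂ ([] , _ , refl , [] , i)
mid-⊆⁻ (u ∷ us) M vs (_ ∷ʳ i)   = map-⊎ (u ∷ʳ_) (λ (s₁ , s₂ , eq , p , q) → s₁ , s₂ , eq , u ∷ʳ p , q) (mid-⊆⁻ us M vs i)
mid-⊆⁻ (u ∷ us) M vs (refl ∷ i) = map-⊎ (refl ∷_) (λ (s₁ , s₂ , eq , p , q) → u ∷ s₁ , s₂ , cong (u ∷_) eq , refl ∷ p , q) (mid-⊆⁻ us M vs i)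

mid-Elems : ∀ {Q : ℕ → Set} us M vs → Elems Q (us ++ vs) → Q M → Elems Q (us ++ M ∷ vs)
mid-Elems us M vs p q i with mid-⊆⁻ us M vs i
... | inj₁ j = p j
... | inj₂ ([]    , _ , refl , _) = q
... | inj₂ (_ ∷ [] , _ , () , _)
... | inj₂ (_ ∷ _ ∷ _ , _ , () , _)

-- The inserted entry is the unique strict maximum, so it marks the place of insertion.
mid-injective : ∀ us us′ {M M′ vs vs′} → Elems (_< M) (us ++ vs) → Elems (_< M′) (us′ ++ vs′) →
  us ++ M ∷ vs ≡ us′ ++ M′ ∷ vs′ → us ≡ us′ × M ≡ M′ × vs ≡ vs′
mid-injective us us′ {M} {M′} {vs} {vs′} p p′ eq with go
  where
  le : ∀ {M M′ us vs us′ vs′} → Elems (_< M′) (us′ ++ vs′) → us ++ M ∷ vs ≡ us′ ++ M′ ∷ vs′ → M ≤ M′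
  le {M} {M′} {us} {vs} {us′} {vs′} q eq = mid-Elems {_≤ M′} us′ M′ vs′ (λ i → <⇒≤ (q i)) ≤-refl (subst ([ M ] ⊆_) eq (mid∈ us M vs))
  go : M ≡ M′
  go = ≤-antisym (le {us = us} p′ eq) (le {us = us′} p (sym eq))
... | refl = let (a , b) = split us us′ p p′ eq in a , refl , b
  where
  split : ∀ us us′ → Elems (_< M) (us ++ vs) → Elems (_< M) (us′ ++ vs′) → us ++ M ∷ vs ≡ us′ ++ M ∷ vs′ → us ≡ us′ × vs ≡ vs′
  split []       []        p p′ eq = refl , proj₂ (∷-injective eq)
  split []       (u ∷ us′) p p′ eq = ⊥-elim (<⇒≢ (p′ (refl ∷ minimum _)) (sym (proj₁ (∷-injective eq))))
  split (u ∷ us) []        p p′ eq = ⊥-elim (<⇒≢ (p (refl ∷ minimum _)) (proj₁ (∷-injective eq)))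
  split (u ∷ us) (u′ ∷ us′) p p′ eq with ∷-injective eq
  ... | refl , eq′ with split us us′ (λ i → p (u ∷ʳ i)) (λ i → p′ (u ∷ʳ i)) eq′
  ...   | refl , r = refl , r

-- Insertion of a maximum

record Valid (e : List ℕ) : Set where
  field
    bounded : Bounded 0 e
    avoid   : Avoids T₀ e

record Insertable (us : List ℕ) (M : ℕ) (vs : List ℕ) : Set where
  field
    smaller : Elems (_< M) (us ++ vs)
    room    : M ≤ length us
    decr    : Decr vs
    positive : 0 < M

module _ {us M vs} (I : Insertable us M vs) where
  open Insertable I

  us<M : Elems (_< M) us
  us<M i = smaller (++⁺ʳ vs i)

  vs<M : Elems (_< M) vs
  vs<M i = smaller (++⁺ˡ us i)

  -- As strict maximum, M can take part in an occurrence only as the 2 of 201, and then its 01 would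
  -- be a rise inside `vs`.
  Valid-insert : Valid (us ++ vs) → Valid (us ++ M ∷ vs)
  Valid-insert v = record { bounded = bnd ; avoid = av (Valid.avoid v) }
    where
    bnd : Bounded 0 (us ++ M ∷ vs)
    bnd = Bounded-++⁺ 0 us (proj₁ (Bounded-++⁻ 0 us (Valid.bounded v)))
      (room , Bounded-const (suc (length us)) vs (λ i → m≤n⇒m≤1+n (≤-trans (<⇒≤ (vs<M i)) room)))
    av : Avoids T₀ (us ++ vs) → Avoids T₀ (us ++ M ∷ vs)
    av (p ∷ q ∷ []) = ¬-not no-011 ∷ ¬-not no-201 ∷ []
      where
      no-011 : ¬ contains (us ++ M ∷ vs) p011 ≡ true
      no-011 r with contains⁻ 0 1 1 (us ++ M ∷ vs) r
      ... | x , y , z , i , o@(x<y , x<z , y≡z) with mid-⊆⁻ us M vs i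
      ...   | inj₁ j with () ← trans (sym p) (contains⁺ 0 1 1 (us ++ vs) j o)
      no-011 r | x , y , z , i , (x<y , x<z , y≡z) | inj₂ ([] , _ , refl , _ , j) = <-asym x<y (vs<M (fst⊆ j))
      no-011 r | x , y , z , i , (x<y , x<z , y≡z) | inj₂ (_ ∷ [] , _ , refl , _ , j) = <⇒≢ (vs<M j) (sym y≡z)
      no-011 r | x , y , z , i , (x<y , x<z , y≡z) | inj₂ (_ ∷ _ ∷ [] , _ , refl , j , _) = <⇒≢ (us<M (snd⊆ j)) y≡z
      no-011 r | x , y , z , i , (x<y , x<z , y≡z) | inj₂ (_ ∷ _ ∷ _ ∷ [] , _ , () , _)
      no-011 r | x , y , z , i , (x<y , x<z , y≡z) | inj₂ (_ ∷ _ ∷ _ ∷ _ ∷ _ , _ , () , _)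
      no-201 : ¬ contains (us ++ M ∷ vs) p201 ≡ true
      no-201 r with contains⁻ 2 0 1 (us ++ M ∷ vs) r
      ... | x , y , z , i , o@(y<x , z<x , y<z) with mid-⊆⁻ us M vs i
      ...   | inj₁ j with () ← trans (sym q) (contains⁺ 2 0 1 (us ++ vs) j o)
      no-201 r | x , y , z , i , (y<x , z<x , y<z) | inj₂ ([] , _ , refl , _ , j) = <⇒≱ y<z (decr j)
      no-201 r | x , y , z , i , (y<x , z<x , y<z) | inj₂ (_ ∷ [] , _ , refl , j , _) = <-asym y<x (us<M j)
      no-201 r | x , y , z , i , (y<x , z<x , y<z) | inj₂ (_ ∷ _ ∷ [] , _ , refl , j , _) = <-asym z<x (us<M (fst⊆ j))
      no-201 r | x , y , z , i , (y<x , z<x , y<z) | inj₂ (_ ∷ _ ∷ _ ∷ [] , _ , () , _)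
      no-201 r | x , y , z , i , (y<x , z<x , y<z) | inj₂ (_ ∷ _ ∷ _ ∷ _ ∷ _ , _ , () , _)

  -- The entries of `vs` move one place to the left but stay within bounds, being below M, which is
  -- at most the length of `us`.
  Valid-delete : Valid (us ++ M ∷ vs) → Valid (us ++ vs)
  Valid-delete v = record
    { bounded = Bounded-++⁺ 0 us (proj₁ (Bounded-++⁻ 0 us (Valid.bounded v)))
        (Bounded-const (length us) vs (λ i → ≤-trans (<⇒≤ (vs<M i)) room))
    ; avoid = All.map (λ {f} p → ¬-not (λ q → true≢false (trans (sym (contains-mono (us ++ vs) (us ++ M ∷ vs) f (mid-⊆⁺ us M vs) q)) p))) (Valid.avoid v)
    }
    where
    true≢false : true ≢ false
    true≢false ()

length-insert : ∀ (us : List ℕ) M vs → length (us ++ M ∷ vs) ≡ suc (length (us ++ vs))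
length-insert []       M vs = refl
length-insert (u ∷ us) M vs = cong suc (length-insert us M vs)

zeros-insert : ∀ us M vs → 0 < M → zeros (us ++ M ∷ vs) ≡ zeros (us ++ vs)
zeros-insert []       (suc M) vs lt = refl
zeros-insert (u ∷ us) M       vs lt = cong (ι (u ≡ᵇ 0) +_) (zeros-insert us M vs lt)

maxEntry-bound : ∀ e → Elems (_≤ maxEntry e) e
maxEntry-bound (x ∷ e) (refl ∷ _) = m≤m⊔n x (maxEntry e)
maxEntry-bound (x ∷ e) (_ ∷ʳ i)   = ≤-trans (maxEntry-bound e i) (m≤n⊔m x (maxEntry e))

maxEntry-least : ∀ e m → Elems (_≤ m) e → maxEntry e ≤ m
maxEntry-least []      m p = z≤n
maxEntry-least (x ∷ e) m p = ⊔-lub (p (refl ∷ minimum e)) (maxEntry-least e m (λ i → p (x ∷ʳ i)))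

maxEntry-insert : ∀ {us M vs} → Insertable us M vs → maxEntry (us ++ M ∷ vs) ≡ M
maxEntry-insert {us} {M} {vs} I = ≤-antisym
  (maxEntry-least _ M (mid-Elems {_≤ M} us M vs (λ i → <⇒≤ (Insertable.smaller I i)) ≤-refl))
  (maxEntry-bound (us ++ M ∷ vs) (mid∈ us M vs))

highFrom-none : ∀ m vs → Elems (_< m) vs → highFrom m vs ≡ 0
highFrom-none m []       p = refl
highFrom-none m (v ∷ vs) p rewrite ≢⇒≡ᵇ≡ (<⇒≢ (p (refl ∷ minimum vs))) = highFrom-none (suc m) vs (λ i → m<n⇒m<1+n (p (v ∷ʳ i)))

-- The entries behind M lie below M and hence below their positions, so none is high before or after
-- the insertion.
highFrom-insert : ∀ m us M vs → Elems (_< M) vs → M ≤ m + length us →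
  highFrom m (us ++ M ∷ vs) ≡ bump (M ≡ᵇ m + length us) (highFrom m (us ++ vs))
highFrom-insert m []       M vs p le
  rewrite +-identityʳ m | highFrom-none m vs (λ i → <-≤-trans (p i) le)
        | highFrom-none (suc m) vs (λ i → m<n⇒m<1+n (<-≤-trans (p i) le)) = trans (+-identityʳ _) (sym (bump≡+ι (M ≡ᵇ m) 0))
highFrom-insert m (u ∷ us) M vs p le =
  trans (cong (ι (u ≡ᵇ m) +_) (highFrom-insert (suc m) us M vs p (subst (M ≤_) (+-suc m (length us)) le)))
  (trans (+-bumpʳ (M ≡ᵇ suc m + length us) (ι (u ≡ᵇ m)) _)
    (cong (λ z → bump (M ≡ᵇ z) (ι (u ≡ᵇ m) + highFrom (suc m) (us ++ vs))) (sym (+-suc m (length us)))))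

all>-insert : ∀ us M vs x → x < M → all (λ y → x <ᵇ y) (us ++ M ∷ vs) ≡ all (λ y → x <ᵇ y) (us ++ vs)
all>-insert []       M vs x lt rewrite <⇒<ᵇ≡ lt = refl
all>-insert (u ∷ us) M vs x lt = cong ((x <ᵇ u) ∧_) (all>-insert us M vs x lt)

-- Entries before M keep their status, since M exceeds them; M itself counts only at the very end.
rtlMin-insert : ∀ us M vs → Elems (_< M) (us ++ vs) → rtlMin (us ++ M ∷ vs) ≡ bump (length vs ≡ᵇ 0) (rtlMin (us ++ vs))
rtlMin-insert []       M []       p = refl
rtlMin-insert []       M (v ∷ vs) p rewrite ≥⇒<ᵇ≡ (<⇒≤ (p (refl ∷ minimum vs))) = refl
rtlMin-insert (u ∷ us) M vs       p
  rewrite all>-insert us M vs u (p (refl ∷ minimum _)) | rtlMin-insert us M vs (λ i → p (u ∷ʳ i)) = +-bumpʳ (length vs ≡ᵇ 0) _ _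

-- The run begins at M, because every entry before M is smaller.
decSuf-insert : ∀ us M vs → Elems (_< M) (us ++ vs) → Decr vs → decSuf (us ++ M ∷ vs) ≡ suc (length vs)
decSuf-insert []       M vs p d
  rewrite decSuf-Decr vs d | ≡ᵇ-refl (length vs) | all<-true vs (suc M) (λ i → m<n⇒m<1+n (p i)) = refl
decSuf-insert (u ∷ us) M vs p d
  rewrite all<-false (us ++ M ∷ vs) (suc u) (mid∈ us M vs) (p (refl ∷ minimum _)) | ∧-zeroʳ (decSuf (us ++ M ∷ vs) ≡ᵇ length (us ++ M ∷ vs))
  = decSuf-insert us M vs (λ i → p (u ∷ʳ i)) d

front back : ℕ → List ℕ → List ℕ
front b e = take (length e ∸ b) e
back  b e = drop (length e ∸ b) e

insert : ℕ → ℕ → List ℕ → List ℕ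
insert b M e = front b e ++ M ∷ back b e

front++back : ∀ b e → front b e ++ back b e ≡ e
front++back b e = take++drop≡id (length e ∸ b) e

length-front : ∀ b e → length (front b e) ≡ length e ∸ b
length-front b e = trans (length-take (length e ∸ b) e) (m≤n⇒m⊓n≡m (m∸n≤m (length e) b))

length-back : ∀ b e → b ≤ length e → length (back b e) ≡ b
length-back b e le = trans (length-drop (length e ∸ b) e) (m∸[m∸n]≡n le)

insert-++ : ∀ us M vs → insert (length vs) M (us ++ vs) ≡ us ++ M ∷ vs
insert-++ us M vs rewrite length-++ us {vs} | m+n∸n≡m (length us) (length vs) = cong₂ (λ a b → a ++ M ∷ b) (take-length us) (drop-length us)
  where
  take-length : ∀ us → take (length us) (us ++ vs) ≡ us
  take-length []       = refl
  take-length (u ∷ us) = cong (u ∷_) (take-length us)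
  drop-length : ∀ us → drop (length us) (us ++ vs) ≡ vs
  drop-length []       = refl
  drop-length (u ∷ us) = drop-length us

-- The parameter `a` fixes the new maximum `length e ∸ a` and thereby the new bounce a + 1; `b` is
-- the number of entries behind it. The bound b ≤ a says that the maximum does not exceed its
-- position, and b ≤ `decSuf e` that a decreasing run follows.
row : List ℕ → ℕ → List (List ℕ)
row e a = map (λ b → insert b (length e ∸ a) e) (upTo (suc (decSuf e) ⊓ suc a))

children : List ℕ → List (List ℕ)
children e = concatMap (row e) (upTo (bounce e))

gen : ℕ → ℕ → List (List ℕ)
gen zero    z = [ replicate z 0 ]
gen (suc k) z = concatMap children (gen k z)

maxEntry≤length : ∀ m e → Bounded m e → maxEntry e ≤ m + length e
maxEntry≤length m []      b = z≤n
maxEntry≤length m (x ∷ e) (p , b) = ⊔-lub (≤-trans p (m≤m+n m _)) (subst (maxEntry e ≤_) (sym (+-suc m (length e))) (maxEntry≤length (suc m) e b))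

module _ (e : List ℕ) {a b} (a<bounce : a < bounce e) (b<min : b < suc (decSuf e) ⊓ suc a) where

  private
    M = length e ∸ a
    b≤decSuf : b ≤ decSuf e
    b≤decSuf = s≤s⁻¹ (<-≤-trans b<min (m⊓n≤m _ (suc a)))
    b≤a : b ≤ a
    b≤a = s≤s⁻¹ (<-≤-trans b<min (m⊓n≤n (suc (decSuf e)) _))
    b≤length : b ≤ length e
    b≤length = ≤-trans b≤decSuf (decSuf≤length e)
    a<length : a < length e
    a<length = ≤-trans a<bounce (m∸n≤m (length e) (maxEntry e))
    max<M : maxEntry e < M
    max<M = m+n≤o⇒m≤o∸n (suc (maxEntry e)) (≤-trans (≤-reflexive (cong suc (+-comm (maxEntry e) a)))
      (m≤o∸n⇒m+n≤o (suc a) (<⇒≤ (m∸n≢0⇒n<m (λ eq → <⇒≱ a<bounce (subst (_≤ a) (sym eq) z≤n)))) a<bounce))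

  child-Insertable : Insertable (front b e) M (back b e)
  child-Insertable = record
    { smaller = subst (Elems (_< M)) (sym (front++back b e)) (λ i → ≤-<-trans (maxEntry-bound e i) max<M)
    ; room = subst (M ≤_) (sym (length-front b e)) (∸-monoʳ-≤ (length e) b≤a)
    ; positive = ≤-<-trans z≤n max<M
    ; decr = ≤decSuf⇒Decr (front b e) (back b e) (subst₂ _≤_ (sym (length-back b e b≤length)) (cong decSuf (sym (front++back b e))) b≤decSuf)
    }

  child-length : length (insert b M e) ≡ suc (length e)
  child-length = trans (length-insert (front b e) M (back b e)) (cong (suc ∘ length) (front++back b e))

  child-Valid : Valid e → Valid (insert b M e)
  child-Valid v = Valid-insert child-Insertable (subst Valid (sym (front++back b e)) v)

  child-zeros : zeros (insert b M e) ≡ zeros e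
  child-zeros = trans (zeros-insert (front b e) M (back b e) (Insertable.positive child-Insertable)) (cong zeros (front++back b e))

  child-bounce : bounce (insert b M e) ≡ suc a
  child-bounce = trans (cong₂ _∸_ child-length (maxEntry-insert child-Insertable))
    (trans (+-∸-assoc 1 (m∸n≤m (length e) a)) (cong suc (m∸[m∸n]≡n (<⇒≤ a<length))))

  child-decSuf : decSuf (insert b M e) ≡ suc b
  child-decSuf = trans (decSuf-insert (front b e) M (back b e) (Insertable.smaller child-Insertable) (Insertable.decr child-Insertable))
    (cong suc (length-back b e b≤length))

  child-rtlMin : rtlMin (insert b M e) ≡ bump (b ≡ᵇ 0) (rtlMin e)
  child-rtlMin = trans (rtlMin-insert (front b e) M (back b e) (Insertable.smaller child-Insertable))
    (cong₂ (λ l u → bump (l ≡ᵇ 0) (rtlMin u)) (length-back b e b≤length) (front++back b e))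

  child-high : high (insert b M e) ≡ bump (b ≡ᵇ a) (high e)
  child-high = trans (highFrom-insert 0 (front b e) M (back b e) (vs<M child-Insertable) (Insertable.room child-Insertable))
    (cong₂ (λ t u → bump t (high u)) (trans (cong (M ≡ᵇ_) (length-front b e)) same) (front++back b e))
    where
    -- M equals its position `length e ∸ b` exactly when a = b, by cancellation in the truncated
    -- difference.
    same : (M ≡ᵇ length e ∸ b) ≡ (b ≡ᵇ a)
    same with b ≟ a
    ... | yes refl = trans (≡ᵇ-refl M) (sym (≡ᵇ-refl b))
    ... | no  b≢a  = trans (≢⇒≡ᵇ≡ (λ eq → b≢a (sym (∸-cancelˡ-≡ (<⇒≤ a<length) b≤length eq)))) (sym (≢⇒≡ᵇ≡ b≢a))

∈-children⁻ : ∀ e {e′} → e′ ∈ children e → ∃[ a ] ∃[ b ] a < bounce e × b < suc (decSuf e) ⊓ suc a × e′ ≡ insert b (length e ∸ a) e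
∈-children⁻ e i with find (∈-concatMap⁻ (row e) i)
... | a , j , k with ∈-map⁻ (λ b → insert b (length e ∸ a) e) k
...   | b , l , eq = a , b , ∈-upTo⁻ j , ∈-upTo⁻ l , eq

∈-children⁺ : ∀ {us M vs} → Insertable us M vs → us ++ M ∷ vs ∈ children (us ++ vs)
∈-children⁺ {us} {M} {vs} I = subst (_∈ children (us ++ vs)) eq
  (∈-concatMap⁺ (row (us ++ vs)) (lose (∈-upTo⁺ a<bounce) (∈-map⁺ (λ b → insert b (n ∸ a) (us ++ vs)) (∈-upTo⁺ b<min))))
  where
  open Insertable I
  n = length (us ++ vs)
  a = n ∸ M
  n≡ : n ≡ length us + length vs
  n≡ = length-++ us
  M≤n : M ≤ n
  M≤n = ≤-trans room (≤-trans (m≤m+n (length us) (length vs)) (≤-reflexive (sym n≡)))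
  eq : insert (length vs) (n ∸ a) (us ++ vs) ≡ us ++ M ∷ vs
  eq = trans (cong (λ z → insert (length vs) z (us ++ vs)) (m∸[m∸n]≡n M≤n)) (insert-++ us M vs)
  max<M : ∀ {M} → 0 < M → Elems (_< M) (us ++ vs) → maxEntry (us ++ vs) < M
  max<M (s≤s _) p = s≤s (maxEntry-least (us ++ vs) _ (λ i → s≤s⁻¹ (p i)))
  a<bounce : a < n ∸ maxEntry (us ++ vs)
  a<bounce = ∸-monoʳ-< (max<M positive smaller) M≤n
  b<min : length vs < suc (decSuf (us ++ vs)) ⊓ suc a
  b<min = ⊓-pres-m< (s≤s (Decr⇒≤decSuf us vs decr))
    (s≤s (m+n≤o⇒m≤o∸n (length vs) (≤-trans (+-monoʳ-≤ (length vs) room) (≤-reflexive (trans (+-comm (length vs) _) (sym n≡))))))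

-- `rtl` and `hig` record positivity, so that `pred` loses nothing when these statistics become the
-- exponents of u and Y.
record InGen (n z : ℕ) (e : List ℕ) : Set where
  field
    valid   : Valid e
    length≡ : length e ≡ n
    zeros≡  : zeros e ≡ z
    rtl     : ∃[ i ] rtlMin e ≡ suc i
    hig     : ∃[ j ] high e ≡ suc j

Elems-replicate : ∀ z → Elems (_≡ 0) (replicate z 0)
Elems-replicate (suc z) (refl ∷ i) = refl
Elems-replicate (suc z) (_ ∷ʳ i)   = Elems-replicate z i

Decr-replicate : ∀ z → Decr (replicate z 0)
Decr-replicate z i = subst (_≤ _) (sym (Elems-replicate z (snd⊆ i))) z≤n

zeros-replicate : ∀ z → zeros (replicate z 0) ≡ z
zeros-replicate zero    = refl
zeros-replicate (suc z) = cong suc (zeros-replicate z)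

maxEntry-replicate : ∀ z → maxEntry (replicate z 0) ≡ 0
maxEntry-replicate z = n≤0⇒n≡0 (maxEntry-least (replicate z 0) 0 (λ i → ≤-reflexive (Elems-replicate z i)))

rtlMin-replicate : ∀ z → rtlMin (replicate (suc z) 0) ≡ 1
rtlMin-replicate zero    = refl
rtlMin-replicate (suc z) = rtlMin-replicate z

high-replicate : ∀ z → high (replicate (suc z) 0) ≡ 1
high-replicate z = cong suc (highFrom-none 1 (replicate z 0) (λ i → s≤s (≤-reflexive (Elems-replicate z i))))

Valid-replicate : ∀ z → Valid (replicate z 0)
Valid-replicate z = record
  { bounded = Bounded-const 0 (replicate z 0) (λ i → ≤-reflexive (Elems-replicate z i))
  ; avoid = ¬-not (λ r → let (x , y , _ , i , x<y , _) = contains⁻ 0 1 1 (replicate z 0) r in <⇒≱ x<y (positive (Elems-replicate z (two i))))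
          ∷ ¬-not (λ r → let (x , y , _ , i , y<x , _) = contains⁻ 2 0 1 (replicate z 0) r in <⇒≱ y<x (positive (Elems-replicate z (one i)))) ∷ []
  }
  where
  positive : ∀ {x y} → x ≡ 0 → x ≤ y
  positive refl = z≤n
  one : ∀ {x y w : ℕ} {e} → (x ∷ y ∷ w ∷ []) ⊆ e → [ x ] ⊆ e
  one = ⊆-trans (refl ∷ minimum _)
  two : ∀ {x y w : ℕ} {e} → (x ∷ y ∷ w ∷ []) ⊆ e → [ y ] ⊆ e
  two = ⊆-trans (_ ∷ʳ refl ∷ minimum _)

bumped : ∀ b {m} → ∃[ i ] m ≡ suc i → ∃[ i ] bump b m ≡ suc i
bumped false p = p
bumped true  p = _ , refl

∈-gen⁻ : ∀ k z {e} → e ∈ gen k (suc z) → InGen (k + suc z) (suc z) e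
∈-gen⁻ zero    z (here refl) = record
  { valid = Valid-replicate (suc z) ; length≡ = length-replicate (suc z) ; zeros≡ = zeros-replicate (suc z)
  ; rtl = 0 , rtlMin-replicate z ; hig = 0 , high-replicate z }
∈-gen⁻ (suc k) z i with find (∈-concatMap⁻ children i)
... | e , j , l with ∈-children⁻ e l | ∈-gen⁻ k z j
...   | a , b , p , q , refl | G = record
  { valid = child-Valid e p q (InGen.valid G)
  ; length≡ = trans (child-length e p q) (cong suc (InGen.length≡ G))
  ; zeros≡ = trans (child-zeros e p q) (InGen.zeros≡ G)
  ; rtl = let (i , eq) = bumped (b ≡ᵇ 0) (InGen.rtl G) in i , trans (child-rtlMin e p q) eq
  ; hig = let (j , eq) = bumped (b ≡ᵇ a) (InGen.hig G) in j , trans (child-high e p q) eq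
  }

zeros≤length : ∀ e → zeros e ≤ length e
zeros≤length []          = z≤n
zeros≤length (zero ∷ e)  = s≤s (zeros≤length e)
zeros≤length (suc x ∷ e) = m≤n⇒m≤1+n (zeros≤length e)

zeros-full : ∀ e → zeros e ≡ length e → e ≡ replicate (length e) 0
zeros-full []          eq = refl
zeros-full (zero ∷ e)  eq = cong (0 ∷_) (zeros-full e (suc-injective eq))
zeros-full (suc x ∷ e) eq = ⊥-elim (<⇒≱ (≤-reflexive (sym eq)) (zeros≤length e))

maxEntry-zero : ∀ e → maxEntry e ≡ 0 → zeros e ≡ length e
maxEntry-zero []          eq = refl
maxEntry-zero (zero ∷ e)  eq = cong suc (maxEntry-zero e eq)
maxEntry-zero (suc x ∷ e) eq = ⊥-elim (<⇒≱ (s≤s z≤n) (≤-trans (m≤m⊔n (suc x) (maxEntry e)) (≤-reflexive eq)))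

maxEntry-split : ∀ e → 0 < maxEntry e → ∃[ us ] ∃[ vs ] e ≡ us ++ maxEntry e ∷ vs
maxEntry-split (x ∷ e) p with ≤-total (maxEntry e) x
... | inj₁ le rewrite m≥n⇒m⊔n≡m le = [] , e , refl
... | inj₂ le rewrite m≤n⇒m⊔n≡n le = let (us , vs , eq) = maxEntry-split e p in x ∷ us , vs , cong (x ∷_) eq

-- The first entry is 0, so a second copy of the positive maximum would complete 011; a rise behind
-- the maximum would complete 201.
Insertable-max : ∀ us M vs → 0 < M → maxEntry (us ++ M ∷ vs) ≡ M → Valid (us ++ M ∷ vs) → Insertable us M vs
Insertable-max []       M vs p max v = ⊥-elim (<⇒≱ p (proj₁ (Valid.bounded v)))
Insertable-max (u ∷ us) M vs p max v with n≤0⇒n≡0 (proj₁ (Valid.bounded v)) | Valid.avoid v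
... | refl | no-011 ∷ no-201 ∷ [] = record
  { smaller  = smaller
  ; room     = proj₁ (proj₂ (Bounded-++⁻ 0 (0 ∷ us) (Valid.bounded v)))
  ; positive = p
  ; decr     = decr
  }
  where
  e = 0 ∷ us ++ M ∷ vs
  absurd : ∀ {A : Set} {b} → b ≡ true → b ≡ false → A
  absurd refl ()
  ≤M : Elems (_≤ M) e
  ≤M i = subst (_ ≤_) max (maxEntry-bound e i)
  repeated : (M ∷ M ∷ []) ⊆ us ++ M ∷ vs → ⊥
  repeated i = absurd (contains⁺ 0 1 1 e (refl ∷ i) (p , p , refl)) no-011
  smaller′ : Elems (_< M) (us ++ vs)
  smaller′ {x} i with m≤n⇒m<n∨m≡n (≤M (0 ∷ʳ ⊆-trans i (mid-⊆⁺ us M vs)))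
  ... | inj₁ x<M  = x<M
  ... | inj₂ refl = ⊥-elim (repeated (twice us i))
    where
    twice : ∀ us → [ x ] ⊆ us ++ vs → (x ∷ x ∷ []) ⊆ us ++ x ∷ vs
    twice []       i          = refl ∷ i
    twice (u ∷ us) (_ ∷ʳ i)   = u ∷ʳ twice us i
    twice (u ∷ us) (refl ∷ i) = refl ∷ mid∈ us x vs
  smaller : Elems (_< M) (0 ∷ us ++ vs)
  smaller (refl ∷ i) = p
  smaller (_ ∷ʳ i)   = smaller′ i
  decr : Decr vs
  decr {y} {z} i with z ≤? y
  ... | yes z≤y = z≤y
  ... | no  z≰y = absurd (contains⁺ 2 0 1 e (0 ∷ʳ ++⁺ˡ us (refl ∷ i))
    (smaller′ (++⁺ˡ us (fst⊆ i)) , smaller′ (++⁺ˡ us (snd⊆ i)) , ≰⇒> z≰y)) no-201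

∈-gen⁺ : ∀ k z {e} → Valid e → length e ≡ k + z → zeros e ≡ z → e ∈ gen k z
∈-gen⁺ zero    z {e} v l q = here (trans (zeros-full e (trans q (sym l))) (cong (λ n → replicate n 0) l))
∈-gen⁺ (suc k) z {e} v l q with maxEntry e in max
-- With maximum 0 all k + 1 + z entries would be zeros, but there are only z.
... | zero  = ⊥-elim (<⇒≱ (m<n+m z {suc k} (s≤s z≤n)) (≤-reflexive (trans (sym l) (trans (sym (maxEntry-zero e max)) q))))
... | suc m with maxEntry-split e (subst (0 <_) (sym max) (s≤s z≤n))
...   | us , vs , eq with trans eq (cong (λ M → us ++ M ∷ vs) max)
...     | refl = ∈-concatMap⁺ children (lose
  (∈-gen⁺ k z (Valid-delete I v) (suc-injective (trans (sym (length-insert us (suc m) vs)) l))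
    (trans (sym (zeros-insert us (suc m) vs (s≤s z≤n))) q))
  (∈-children⁺ I))
  where
  I : Insertable us (suc m) vs
  I = Insertable-max us (suc m) vs (s≤s z≤n) max v

insert-injective : ∀ e e′ {a a′ b b′} → a < bounce e → b < suc (decSuf e) ⊓ suc a → a′ < bounce e′ → b′ < suc (decSuf e′) ⊓ suc a′ →
  insert b (length e ∸ a) e ≡ insert b′ (length e′ ∸ a′) e′ → e ≡ e′ × a ≡ a′ × b ≡ b′
insert-injective e e′ {a} {a′} {b} {b′} p q p′ q′ eq
  with mid-injective (front b e) (front b′ e′) (Insertable.smaller (child-Insertable e p q)) (Insertable.smaller (child-Insertable e′ p′ q′)) eq
... | f , M≡ , g with trans (sym (front++back b e)) (trans (cong₂ _++_ f g) (front++back b′ e′))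
...   | refl = refl , ∸-cancelˡ-≡ (a≤ p) (a≤ p′) M≡ ,
  trans (sym (length-back b e (b≤ q))) (trans (cong length g) (length-back b′ e (b≤ q′)))
  where
  a≤ : ∀ {a} → a < bounce e → a ≤ length e
  a≤ p = ≤-trans (<⇒≤ p) (m∸n≤m (length e) (maxEntry e))
  b≤ : ∀ {b c} → b < suc (decSuf e) ⊓ c → b ≤ length e
  b≤ q = ≤-trans (s≤s⁻¹ (<-≤-trans q (m⊓n≤m _ _))) (decSuf≤length e)

Unique-gen : ∀ k z → Unique (gen k z)
Unique-gen zero    z = [] ∷ []
Unique-gen (suc k) z = Unique-concatMap children (Unique-gen k z) (λ {e} _ → Unique-children e) same-parent
  where
  Unique-children : ∀ e → Unique (children e)
  Unique-children e = Unique-concatMap (row e) (Unique.upTo⁺ (bounce e))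
    (λ {a} i → Unique-map (λ b → insert b (length e ∸ a) e) (Unique.upTo⁺ _)
      (λ j k eq → proj₂ (proj₂ (insert-injective e e (∈-upTo⁻ i) (∈-upTo⁻ j) (∈-upTo⁻ i) (∈-upTo⁻ k) eq))))
    same-row
    where
    same-row : ∀ {a a′ y} → a ∈ upTo (bounce e) → a′ ∈ upTo (bounce e) → y ∈ row e a → y ∈ row e a′ → a ≡ a′
    same-row {a} {a′} i i′ j j′ with ∈-map⁻ (λ b → insert b (length e ∸ a) e) j | ∈-map⁻ (λ b → insert b (length e ∸ a′) e) j′
    ... | b , l , eq | b′ , l′ , eq′ = proj₁ (proj₂ (insert-injective e e (∈-upTo⁻ i) (∈-upTo⁻ l) (∈-upTo⁻ i′) (∈-upTo⁻ l′) (trans (sym eq) eq′)))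
  same-parent : ∀ {e e′ y} → e ∈ gen k z → e′ ∈ gen k z → y ∈ children e → y ∈ children e′ → e ≡ e′
  same-parent {e} {e′} _ _ j j′ with ∈-children⁻ e j | ∈-children⁻ e′ j′
  ... | a , b , p , q , eq | a′ , b′ , p′ , q′ , eq′ = proj₁ (insert-injective e e′ p q p′ q′ (trans (sym eq) eq′))

-- Summation over the insertion tree.

sumBy-cong∈ : ∀ {A : Set} {f g : A → ℕ} xs → (∀ {x} → x ∈ xs → f x ≡ g x) → sumBy f xs ≡ sumBy g xs
sumBy-cong∈ []       p = refl
sumBy-cong∈ (x ∷ xs) p = cong₂ _+_ (p (here refl)) (sumBy-cong∈ xs (λ i → p (there i)))

sumBy-upTo : ∀ (f : ℕ → ℕ) h n → sumBy f (applyUpTo h n) ≡ ∑ n (λ k → f (h k))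
sumBy-upTo f h zero    = refl
sumBy-upTo f h (suc n) = cong (f (h 0) +_) (sumBy-upTo f (λ k → h (suc k)) n)

module _ (X : Functional) (X-suc : ∀ K i j d → X (suc K) i j d ≡ 0) where

  weight : ℕ → List ℕ → ℕ
  weight r e = growth X r (bounce e) (decSuf e) (pred (rtlMin e)) (pred (high e))

  pred-bump : ∀ b {m i} → m ≡ suc i → pred (bump b m) ≡ bump b (pred m)
  pred-bump false refl = refl
  pred-bump true  refl = refl

  -- The children supply the double sum in the recursion of `growth`; the root term vanishes, as X
  -- is 0 while powers of t remain.
  sumBy-children : ∀ {n z e} r → InGen n z e → sumBy (weight r) (children e) ≡ weight (suc r) e
  sumBy-children {e = e} r G = begin
    sumBy (weight r) (children e)
      ≡⟨ sumBy-concatMap (weight r) (row e) (upTo (bounce e)) ⟩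
    sumBy (λ a → sumBy (weight r) (row e a)) (upTo (bounce e))
      ≡⟨ sumBy-upTo (λ a → sumBy (weight r) (row e a)) (λ a → a) (bounce e) ⟩
    ∑ (bounce e) (λ a → sumBy (weight r) (row e a))
      ≡⟨ ∑-cong (bounce e) (λ a → sumBy-applyUpTo (weight r) (λ b → insert b (length e ∸ a) e) (λ b → b) (suc (decSuf e) ⊓ suc a)) ⟩
    ∑ (bounce e) (λ a → ∑ (suc (decSuf e) ⊓ suc a) (λ b → weight r (insert b (length e ∸ a) e)))
      ≡⟨ ∑-cong< (bounce e) (λ a p → ∑-cong< (suc (decSuf e) ⊓ suc a) (λ b q → child a b p q)) ⟩
    ∑ (bounce e) (λ a → ∑ (suc (decSuf e) ⊓ suc a) (λ b → growth X r (suc a) (suc b) (bump (b ≡ᵇ 0) (pred (rtlMin e))) (bump (b ≡ᵇ a) (pred (high e)))))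
      ≡⟨ cong (_+ ∑ (bounce e) (λ a → ∑ (suc (decSuf e) ⊓ suc a) (λ b → growth X r (suc a) (suc b) (bump (b ≡ᵇ 0) (pred (rtlMin e))) (bump (b ≡ᵇ a) (pred (high e))))))
           (sym (X-suc r (pred (rtlMin e)) (pred (high e)) (bounce e))) ⟩
    weight (suc r) e ∎
    where
    open ≡-Reasoning
    child : ∀ a b → a < bounce e → b < suc (decSuf e) ⊓ suc a →
      weight r (insert b (length e ∸ a) e) ≡ growth X r (suc a) (suc b) (bump (b ≡ᵇ 0) (pred (rtlMin e))) (bump (b ≡ᵇ a) (pred (high e)))
    child a b p q rewrite child-bounce e p q | child-decSuf e p q | child-rtlMin e p q | child-high e p q
      | pred-bump (b ≡ᵇ 0) (proj₂ (InGen.rtl G)) | pred-bump (b ≡ᵇ a) (proj₂ (InGen.hig G)) = refl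

  -- Generations move one at a time from `gen` into `growth`; at the root 0^{z+1} both labels are z
  -- + 1.
  sumBy-gen : ∀ k r z → sumBy (weight r) (gen k (suc z)) ≡ growth X (r + k) (suc z) (suc z) 0 0
  sumBy-gen zero    r z = begin
    weight r e + 0
      ≡⟨ +-identityʳ _ ⟩
    growth X r (bounce e) (decSuf e) (pred (rtlMin e)) (pred (high e))
      ≡⟨ cong₂ (λ a b → growth X r a b (pred (rtlMin e)) (pred (high e)))
           (cong₂ _∸_ (length-replicate (suc z)) (maxEntry-replicate (suc z)))
           (trans (decSuf-Decr e (Decr-replicate (suc z))) (length-replicate (suc z))) ⟩
    growth X r (suc z) (suc z) (pred (rtlMin e)) (pred (high e))
      ≡⟨ cong₂ (λ i j → growth X r (suc z) (suc z) (pred i) (pred j)) (rtlMin-replicate z) (high-replicate z) ⟩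
    growth X r (suc z) (suc z) 0 0
      ≡⟨ cong (λ n → growth X n (suc z) (suc z) 0 0) (sym (+-identityʳ r)) ⟩
    growth X (r + 0) (suc z) (suc z) 0 0 ∎
    where
    open ≡-Reasoning
    e = replicate (suc z) 0
  sumBy-gen (suc k) r z = begin
    sumBy (weight r) (concatMap children (gen k (suc z)))
      ≡⟨ sumBy-concatMap (weight r) children (gen k (suc z)) ⟩
    sumBy (λ e → sumBy (weight r) (children e)) (gen k (suc z))
      ≡⟨ sumBy-cong∈ (gen k (suc z)) (λ i → sumBy-children r (∈-gen⁻ k z i)) ⟩
    sumBy (weight (suc r)) (gen k (suc z))
      ≡⟨ sumBy-gen k (suc r) z ⟩
    growth X (suc r + k) (suc z) (suc z) 0 0
      ≡⟨ cong (λ n → growth X n (suc z) (suc z) 0 0) (sym (+-suc r k)) ⟩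
    growth X (r + suc k) (suc z) (suc z) 0 0 ∎
    where open ≡-Reasoning

-- Comparison of the joint counts.

-- Extracts one coefficient. The value 0 for `suc K` forces every power of t to be spent, which
-- fixes the length. The indices i, j, d are the bounce less one, zeros less one and high entries on
-- C, and right-to-left minima less one, high entries less one and bounce on the other side.
indicator : ℕ → ℕ → ℕ → Functional
indicator q₁ q₃ q₄ zero    i j d = ι ((suc j ≡ᵇ q₁) ∧ (suc i ≡ᵇ q₃) ∧ (d ≡ᵇ q₄))
indicator q₁ q₃ q₄ (suc K) i j d = 0

∧-swap : ∀ a b c → a ∧ (b ∧ c) ≡ b ∧ (a ∧ c)
∧-swap false false c = refl
∧-swap false true  c = refl
∧-swap true  b     c = refl

indicator-swap : ∀ q₁ q₃ q₄ → indicator q₃ q₁ q₄ ≗₄ swap (indicator q₁ q₃ q₄)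
indicator-swap q₁ q₃ q₄ zero    i j d = cong ι (∧-swap (suc j ≡ᵇ q₃) (suc i ≡ᵇ q₁) (d ≡ᵇ q₄))
indicator-swap q₁ q₃ q₄ (suc K) i j d = refl

R^-cong : ∀ s {X Y} → X ≗₄ Y → R^ s X ≗₄ R^ s Y
R^-cong zero    p = p
R^-cong (suc s) p = R-cong (R^-cong s p)

-- The coefficient of u^{q₃-1} Y^{q₁-1} q^{q₄} t^k in ρ^s(q Σ_m (t u Y)^m), the common value of the
-- counts.
tally : ℕ → ℕ → ℕ → ℕ → ℕ → ℕ
tally k s q₁ q₃ q₄ = Δ (R^ s (indicator q₁ q₃ q₄)) k 0 0

tally-swap : ∀ k s q₁ q₃ q₄ → tally k s q₁ q₃ q₄ ≡ tally k s q₃ q₁ q₄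
tally-swap k s q₁ q₃ q₄ = sym (trans (Δ-cong (R^-cong s (indicator-swap q₁ q₃ q₄)) k 0 0) (Δ-R^-swap s (indicator q₁ q₃ q₄) k))

-- Left-to-right maxima on C and zeros on the other side number between 1 and n, so both counts
-- vanish outside this range.
data Range (n : ℕ) : ℕ → Set where
  none : Range n 0
  in-range : ∀ k s → n ≡ k + suc s → Range n (suc s)
  beyond : ∀ {q} → n < q → Range n q

range : ∀ n q → Range n q
range n zero    = none
range n (suc s) with suc s ≤? n
... | yes le = in-range (n ∸ suc s) s (sym (m∸n+n≡m le))
... | no nle = beyond (≰⇒> nle)

module _ {T : List (List ℕ)} (C : Class T) (q₁ q₃ q₄ : ℕ) where

  private
    off : ∀ q₂ j i b d → b ≢ q₂ → Joint.F T C q₁ q₂ q₃ q₄ j i b d ≡ 0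
    off q₂ j i b d ne rewrite ≢⇒≡ᵇ≡ ne = cong ι (∧-zeroʳ (suc j ≡ᵇ q₁))

  joint-none : ∀ n → 1 ≤ n → jointCount n T zeros ltrMax bounce high q₁ 0 q₃ q₄ ≡ 0
  joint-none (suc r) _ = trans (Joint.jointCount-M T C q₁ 0 q₃ q₄ r) (Tree.M-high (Joint.F T C q₁ 0 q₃ q₄) 0 (off 0) r 0 refl)

  joint-beyond : ∀ n q → 1 ≤ n → n < q → jointCount n T zeros ltrMax bounce high q₁ q q₃ q₄ ≡ 0
  joint-beyond (suc r) q _ lt = trans (Joint.jointCount-M T C q₁ q q₃ q₄ r)
    (Tree.M-low (Joint.F T C q₁ q q₃ q₄) q (off q) r 0 (subst (_< q) (+-comm 1 r) lt))

  joint-tally : ∀ k s → jointCount (k + suc s) T zeros ltrMax bounce high q₁ (suc s) q₃ q₄ ≡ tally k s q₁ q₃ q₄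
  joint-tally k s rewrite +-suc k s = trans (Joint.jointCount-M T C q₁ (suc s) q₃ q₄ (k + s))
    (Tree.M≡Δ (Joint.F T C q₁ (suc s) q₃ q₄) (suc s) (off (suc s)) (indicator q₁ q₃ q₄) base (λ _ _ _ _ → refl) k s 0 refl)
    where
    base : ∀ i j d → Joint.F T C q₁ (suc s) q₃ q₄ j i (suc s) d ≡ indicator q₁ q₃ q₄ 0 i j d
    base i j d rewrite ≡ᵇ-refl s = refl

filterᵇ-none : ∀ {A : Set} (p : A → Bool) xs → (∀ {x} → x ∈ xs → p x ≡ false) → length (filterᵇ p xs) ≡ 0
filterᵇ-none p xs f = trans (length-filterᵇ p xs) (trans (sumBy-cong∈ xs (λ i → cong ι (f i))) (go xs))
  where
  go : ∀ {A : Set} (xs : List A) → sumBy (λ _ → 0) xs ≡ 0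
  go []       = refl
  go (x ∷ xs) = go xs

module _ (q₁ q₂ q₃ q₄ : ℕ) where

  T₀-test : List ℕ → Bool
  T₀-test e = avoidsAll T₀ e ∧ (high e ≡ᵇ q₁) ∧ (zeros e ≡ᵇ q₂) ∧ (rtlMin e ≡ᵇ q₃) ∧ (bounce e ≡ᵇ q₄)

  T₀-test-zeros : ∀ e → zeros e ≢ q₂ → T₀-test e ≡ false
  T₀-test-zeros e ne rewrite ≢⇒≡ᵇ≡ ne | ∧-zeroʳ (high e ≡ᵇ q₁) = ∧-zeroʳ (avoidsAll T₀ e)

  T₀-test-true : ∀ e → T₀-test e ≡ true → Avoids T₀ e × zeros e ≡ q₂
  T₀-test-true e p with ∧-true {avoidsAll T₀ e} p
  ... | av , r = avoidsAll⁻ T₀ e av , ≡ᵇ≡⇒≡ (proj₁ (∧-true {zeros e ≡ᵇ q₂} (proj₂ (∧-true {high e ≡ᵇ q₁} r))))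

  joint₀-off : ∀ n → (∀ {e} → e ∈ invSeqs n → zeros e ≢ q₂) → jointCount n T₀ high zeros rtlMin bounce q₁ q₂ q₃ q₄ ≡ 0
  joint₀-off n ne = filterᵇ-none T₀-test (invSeqs n) (λ {e} i → T₀-test-zeros e (ne i))

joint₀-none : ∀ n q₁ q₃ q₄ → 1 ≤ n → jointCount n T₀ high zeros rtlMin bounce q₁ 0 q₃ q₄ ≡ 0
joint₀-none n q₁ q₃ q₄ p = joint₀-off q₁ 0 q₃ q₄ n (λ i → let (l , b) = ∈-invSeqs⁻ n i in head-zero _ (subst (1 ≤_) (sym l) p) b)
  where
  head-zero : ∀ e → 1 ≤ length e → Bounded 0 e → zeros e ≢ 0
  head-zero (zero ∷ e) _ _ ()

joint₀-beyond : ∀ n q₁ q q₃ q₄ → n < q → jointCount n T₀ high zeros rtlMin bounce q₁ q q₃ q₄ ≡ 0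
joint₀-beyond n q₁ q q₃ q₄ lt = joint₀-off q₁ q q₃ q₄ n (λ {e} i → <⇒≢ (≤-<-trans (zeros≤length e) (subst (_< q) (sym (proj₁ (∈-invSeqs⁻ n i))) lt)))

joint₀-tally : ∀ q₁ q₃ q₄ k s → jointCount (k + suc s) T₀ high zeros rtlMin bounce q₁ (suc s) q₃ q₄ ≡ tally k s q₁ q₃ q₄
joint₀-tally q₁ q₃ q₄ k s = begin
  length (filterᵇ t (invSeqs (k + suc s)))
    ≡⟨ length-filterᵇ-≡ t (Unique-invSeqs (k + suc s)) (Unique-gen k (suc s)) to from ⟩
  length (filterᵇ t (gen k (suc s)))
    ≡⟨ length-filterᵇ t (gen k (suc s)) ⟩
  sumBy (λ e → ι (t e)) (gen k (suc s))
    ≡⟨ sumBy-cong∈ (gen k (suc s)) (λ i → at (∈-gen⁻ k s i)) ⟩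
  sumBy (weight X (λ _ _ _ _ → refl) 0) (gen k (suc s))
    ≡⟨ sumBy-gen X (λ _ _ _ _ → refl) k 0 s ⟩
  growth X k (suc s) (suc s) 0 0
    -- The second label s + 1 of the root is put in the form s + β of `growth-R^`, with β = 1.
    ≡⟨ cong (λ z → growth X k (suc s) z 0 0) (+-comm 1 s) ⟩
  growth X k (suc s) (s + 1) 0 0
    ≡⟨ growth-R^ s X k 1 ⟩
  tally k s q₁ q₃ q₄ ∎
  where
  open ≡-Reasoning
  X = indicator q₁ q₃ q₄
  t = T₀-test q₁ (suc s) q₃ q₄
  to : ∀ {e} → e ∈ invSeqs (k + suc s) → t e ≡ true → e ∈ gen k (suc s)
  to {e} i p with ∈-invSeqs⁻ (k + suc s) i | T₀-test-true q₁ (suc s) q₃ q₄ e p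
  ... | l , b | av , z = ∈-gen⁺ k (suc s) (record { bounded = b ; avoid = av }) l z
  from : ∀ {e} → e ∈ gen k (suc s) → t e ≡ true → e ∈ invSeqs (k + suc s)
  from i _ with ∈-gen⁻ k s i
  ... | G = ∈-invSeqs⁺ (k + suc s) (InGen.length≡ G) (Valid.bounded (InGen.valid G))
  at : ∀ {e} → InGen (k + suc s) (suc s) e → ι (t e) ≡ weight X (λ _ _ _ _ → refl) 0 e
  at {e} G rewrite avoidsAll⁺ T₀ e (Valid.avoid (InGen.valid G)) | InGen.zeros≡ G | ≡ᵇ-refl s
    | proj₂ (InGen.rtl G) | proj₂ (InGen.hig G) = refl

joint-equidistributed : ∀ {T} → Class T → ∀ n → 1 ≤ n → ∀ q₁ q₂ q₃ q₄ →
  jointCount n T zeros ltrMax bounce high q₁ q₂ q₃ q₄ ≡ jointCount n T₀ high zeros rtlMin bounce q₁ q₂ q₃ q₄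
joint-equidistributed C n p q₁ q₂ q₃ q₄ with range n q₂
... | none                = trans (joint-none C q₁ q₃ q₄ n p) (sym (joint₀-none n q₁ q₃ q₄ p))
... | in-range k s refl   = trans (joint-tally C q₁ q₃ q₄ k s) (sym (joint₀-tally q₁ q₃ q₄ k s))
... | beyond lt           = trans (joint-beyond C q₁ q₃ q₄ n q₂ p lt) (sym (joint₀-beyond n q₁ q₂ q₃ q₄ lt))

joint-swap : ∀ {T} → Class T → ∀ n → 1 ≤ n → ∀ q₁ q₂ q₃ q₄ →
  jointCount n T zeros ltrMax bounce high q₁ q₂ q₃ q₄ ≡ jointCount n T zeros ltrMax bounce high q₃ q₂ q₁ q₄
joint-swap C n p q₁ q₂ q₃ q₄ with range n q₂
... | none                = trans (joint-none C q₁ q₃ q₄ n p) (sym (joint-none C q₃ q₁ q₄ n p))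
... | in-range k s refl   = trans (joint-tally C q₁ q₃ q₄ k s) (trans (tally-swap k s q₁ q₃ q₄) (sym (joint-tally C q₃ q₁ q₄ k s)))
... | beyond lt           = trans (joint-beyond C q₁ q₃ q₄ n q₂ p lt) (sym (joint-beyond C q₃ q₁ q₄ n q₂ p lt))

-- From joint counts to cardinalities.

count-cong : ∀ {A : Set} (p p′ : A → Bool) xs → (∀ x → p x ≡ p′ x) → length (filterᵇ p xs) ≡ length (filterᵇ p′ xs)
count-cong p p′ xs eq = trans (length-filterᵇ p xs) (trans (sumBy-cong (λ x → cong ι (eq x)) xs) (sym (length-filterᵇ p′ xs)))

joint-reorder : ∀ n T (s₁ s₂ s₃ s₄ : Stat) q₁ q₂ q₃ q₄ →
  jointCount n T s₁ s₂ s₃ s₄ q₁ q₂ q₃ q₄ ≡ jointCount n T s₃ s₂ s₁ s₄ q₃ q₂ q₁ q₄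
joint-reorder n T s₁ s₂ s₃ s₄ q₁ q₂ q₃ q₄ = count-cong _ _ (invSeqs n)
  (λ e → cong (avoidsAll T e ∧_) (reorder (s₁ e ≡ᵇ q₁) (s₂ e ≡ᵇ q₂) (s₃ e ≡ᵇ q₃) (s₄ e ≡ᵇ q₄)))
  where
  reorder : ∀ a b c d → a ∧ (b ∧ (c ∧ d)) ≡ c ∧ (b ∧ (a ∧ d))
  reorder a b c d = trans (cong (a ∧_) (∧-swap b c d)) (trans (∧-swap a c (b ∧ d)) (cong (c ∧_) (∧-swap a b d)))

refine : (List ℕ → Bool) → Stat → ℕ → List ℕ → Bool
refine p s q e = p e ∧ (s e ≡ᵇ q)

count-refine : ∀ p s xs B → (∀ {e} → e ∈ xs → s e < B) →
  length (filterᵇ p xs) ≡ ∑ B (λ q → length (filterᵇ (refine p s q) xs))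
count-refine p s []       B lt = sym (∑-zero B)
count-refine p s (x ∷ xs) B lt = begin
  length (filterᵇ p (x ∷ xs))
    ≡⟨ length-filterᵇ p (x ∷ xs) ⟩
  ι (p x) + sumBy (λ e → ι (p e)) xs
    ≡⟨ cong₂ _+_ (one (p x) (s x) B (lt (here refl))) (trans (sym (length-filterᵇ p xs)) (count-refine p s xs B (λ i → lt (there i)))) ⟩
  ∑ B (λ q → ι (refine p s q x)) + ∑ B (λ q → length (filterᵇ (refine p s q) xs))
    ≡⟨ ∑-+ B (λ q → ι (refine p s q x)) (λ q → length (filterᵇ (refine p s q) xs)) ⟨
  ∑ B (λ q → ι (refine p s q x) + length (filterᵇ (refine p s q) xs))
    ≡⟨ ∑-cong B (λ q → trans (cong (ι (refine p s q x) +_) (length-filterᵇ (refine p s q) xs)) (sym (length-filterᵇ (refine p s q) (x ∷ xs)))) ⟩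
  ∑ B (λ q → length (filterᵇ (refine p s q) (x ∷ xs))) ∎
  where
  open ≡-Reasoning
  one : ∀ b v B → v < B → ι b ≡ ∑ B (λ q → ι (b ∧ (v ≡ᵇ q)))
  one false v       B       lt       = sym (∑-zero B)
  one true  zero    (suc B) lt       = cong suc (sym (∑-zero B))
  one true  (suc v) (suc B) (s≤s lt) = one true v B lt

sumBy-bound : ∀ (s : Stat) xs {e} → e ∈ xs → s e ≤ sumBy s xs
sumBy-bound s (x ∷ xs) (here refl) = m≤m+n (s x) _
sumBy-bound s (x ∷ xs) (there i)   = ≤-trans (sumBy-bound s xs i) (m≤n+m _ (s x))

equal-totals : ∀ p p′ (s s′ : Stat) xs →
  (∀ q → length (filterᵇ (refine p s q) xs) ≡ length (filterᵇ (refine p′ s′ q) xs)) →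
  length (filterᵇ p xs) ≡ length (filterᵇ p′ xs)
equal-totals p p′ s s′ xs h = trans (count-refine p s xs B (λ i → s≤s (≤-trans (sumBy-bound s xs i) (m≤m+n _ _))))
  (trans (∑-cong B h) (sym (count-refine p′ s′ xs B (λ i → s≤s (≤-trans (sumBy-bound s′ xs i) (m≤n+m _ (sumBy s xs)))))))
  -- One bound that exceeds both statistics on every sequence of the list.
  where B = suc (sumBy s xs + sumBy s′ xs)

-- The joint counts are summed over all values of the statistics, one statistic at a time.
card-equal : ∀ n T T′ (s₁ s₂ s₃ s₄ s₁′ s₂′ s₃′ s₄′ : Stat) →
  (∀ q₁ q₂ q₃ q₄ → jointCount n T s₁ s₂ s₃ s₄ q₁ q₂ q₃ q₄ ≡ jointCount n T′ s₁′ s₂′ s₃′ s₄′ q₁ q₂ q₃ q₄) →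
  card n T ≡ card n T′
card-equal n T T′ s₁ s₂ s₃ s₄ s₁′ s₂′ s₃′ s₄′ h =
  equal-totals (avoidsAll T) (avoidsAll T′) s₁ s₁′ xs λ q₁ →
  equal-totals _ _ s₂ s₂′ xs λ q₂ → equal-totals _ _ s₃ s₃′ xs λ q₃ → equal-totals _ _ s₄ s₄′ xs λ q₄ →
  trans (count-cong _ _ xs (λ e → nest (avoidsAll T e) _ _ _ _)) (trans (h q₁ q₂ q₃ q₄) (sym (count-cong _ _ xs (λ e → nest (avoidsAll T′ e) _ _ _ _))))
  where
  xs = invSeqs n
  nest : ∀ p a b c d → (((p ∧ a) ∧ b) ∧ c) ∧ d ≡ p ∧ (a ∧ (b ∧ (c ∧ d)))
  nest false a     b     c d = refl
  nest true  false b     c d = refl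
  nest true  true  false c d = refl
  nest true  true  true  c d = refl

theorem11 : (n : ℕ) → 1 ≤ n →
    (card n T₁ ≡ card n T₀)
    × ((C : List (List ℕ)) → C ∈ (T₁ ∷ T₂ ∷ T₃ ∷ []) →
    ((q₁ q₂ q₃ q₄ : ℕ) →
    jointCount n C zeros ltrMax bounce high q₁ q₂ q₃ q₄
    ≡ jointCount n T₀ high zeros rtlMin bounce q₁ q₂ q₃ q₄)
    × ((q₁ q₂ q₃ q₄ : ℕ) →
    jointCount n C zeros ltrMax bounce high q₁ q₂ q₃ q₄
    ≡ jointCount n C bounce ltrMax zeros high q₁ q₂ q₃ q₄))
    × ((q₁ q₂ q₃ q₄ : ℕ) →
    jointCount n T₀ high zeros rtlMin bounce q₁ q₂ q₃ q₄
    ≡ jointCount n T₀ rtlMin zeros high bounce q₁ q₂ q₃ q₄)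
theorem11 n p =
  card-equal n T₁ T₀ zeros ltrMax bounce high high zeros rtlMin bounce equi₁ ,
  (λ C i → let K = class-of i in
    joint-equidistributed K n p ,
    λ q₁ q₂ q₃ q₄ → trans (joint-swap K n p q₁ q₂ q₃ q₄) (joint-reorder n C zeros ltrMax bounce high q₃ q₂ q₁ q₄)) ,
  -- The symmetry is carried over from `T₁` by equidistribution.
  λ q₁ q₂ q₃ q₄ → begin
    jointCount n T₀ high zeros rtlMin bounce q₁ q₂ q₃ q₄   ≡⟨ equi₁ q₁ q₂ q₃ q₄ ⟨
    jointCount n T₁ zeros ltrMax bounce high q₁ q₂ q₃ q₄   ≡⟨ joint-swap Decreasing.class n p q₁ q₂ q₃ q₄ ⟩
    jointCount n T₁ zeros ltrMax bounce high q₃ q₂ q₁ q₄   ≡⟨ equi₁ q₃ q₂ q₁ q₄ ⟩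
    jointCount n T₀ high zeros rtlMin bounce q₃ q₂ q₁ q₄   ≡⟨ joint-reorder n T₀ high zeros rtlMin bounce q₃ q₂ q₁ q₄ ⟩
    jointCount n T₀ rtlMin zeros high bounce q₁ q₂ q₃ q₄   ∎
  where
  open ≡-Reasoning
  equi₁ = joint-equidistributed Decreasing.class n p
  class-of : ∀ {C} → C ∈ (T₁ ∷ T₂ ∷ T₃ ∷ []) → Class C
  class-of (here refl)                 = Decreasing.class
  class-of (there (here refl))         = Increasing.class
  class-of (there (there (here refl))) = Sparse.class
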